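{- There exists a finite set $V\subset\mathbb{R}^2$ such that the odd-distance graph on $V$ has chromatic number exactly $6$.
   Context: For a set $V\subset\mathbb{R}^2$, the odd-distance graph on $V$ is the graph with vertex set $V$ in which two distinct vertices are joined by an edge if and only if their Euclidean distance is an odd integer. The chromatic number is the least number of colors in a proper vertex coloring (adjacent vertices receive different colors). -}

module Defs where

open import Data.Fin.Base using (Fin)
open import Data.Integer.Base as ℤ using (ℤ)
open import Data.Nat.Base as ℕ using (ℕ)
import Data.Nat.Properties as ℕ
open import Data.Product.Base using (∃; _×_; _,_; proj₁; proj₂; map₂)
open import Data.Rational.Base as ℚ using (ℚ; 0ℚ; 1ℚ; ½)
import Data.Rational.Properties as ℚ
open import Data.Rational.Solver using (module +-*-Solver)
open import Relation.Binary.Definitions using (Irreflexive; Symmetric)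
open import Relation.Binary.PropositionalEquality
  using (_≡_; _≢_; refl; sym; trans; cong; subst)
open import Relation.Nullary.Negation.Core using (¬_)

-- Real numbers are Cauchy sequences of rationals (with explicit modulus);
-- there are no quotients, so equality is the relation _≈_, "the difference
-- tends to 0".

IsCauchy : (ℕ → ℚ) → Set
IsCauchy s = ∀ ε → 0ℚ ℚ.< ε →
  ∃ λ N → ∀ m n → N ℕ.≤ m → N ℕ.≤ n → ℚ.∣ s m ℚ.- s n ∣ ℚ.< ε

record ℝ : Set where
  constructor mkℝ
  field
    seq      : ℕ → ℚ
    isCauchy : IsCauchy seq

open ℝ public

infix 4 _≈_ _≤_

_≈_ : ℝ → ℝ → Set
x ≈ y = ∀ ε → 0ℚ ℚ.< ε →
  ∃ λ N → ∀ n → N ℕ.≤ n → ℚ.∣ seq x n ℚ.- seq y n ∣ ℚ.< ε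

-- The slack ε is needed because the order must respect _≈_.
_≤_ : ℝ → ℝ → Set
x ≤ y = ∀ ε → 0ℚ ℚ.< ε →
  ∃ λ N → ∀ n → N ℕ.≤ n → seq x n ℚ.< seq y n ℚ.+ ε

private

  open +-*-Solver using (solve; _:+_; _:-_; _:*_; _:=_; :-_)
  open ℚ.≤-Reasoning

  ∣-∣-swap : ∀ p q → ℚ.∣ p ℚ.- q ∣ ≡ ℚ.∣ q ℚ.- p ∣
  ∣-∣-swap p q = trans (sym (ℚ.∣-p∣≡∣p∣ (p ℚ.- q)))
    (cong ℚ.∣_∣ (solve 2 (λ p q → :- (p :- q) := q :- p) refl p q))

  ∣p-p∣<ε : ∀ p {ε} → 0ℚ ℚ.< ε → ℚ.∣ p ℚ.- p ∣ ℚ.< ε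
  ∣p-p∣<ε p {ε} 0<ε =
    subst (λ r → ℚ.∣ r ∣ ℚ.< ε) (sym (ℚ.+-inverseʳ p)) 0<ε

  half-pos : ∀ {ε} → 0ℚ ℚ.< ε → 0ℚ ℚ.< ½ ℚ.* ε
  half-pos {ε} 0<ε =
    subst (ℚ._< ½ ℚ.* ε) (ℚ.*-zeroʳ ½) (ℚ.*-monoʳ-<-pos ½ 0<ε)

  half+half : ∀ ε → ½ ℚ.* ε ℚ.+ ½ ℚ.* ε ≡ ε
  half+half ε = trans (sym (ℚ.*-distribʳ-+ ε ½ ½)) (ℚ.*-identityˡ ε)

  +-isCauchy : ∀ {s t} → IsCauchy s → IsCauchy t →
               IsCauchy (λ n → s n ℚ.+ t n)
  +-isCauchy {s} {t} cs ct ε 0<ε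
    with cs (½ ℚ.* ε) (half-pos 0<ε) | ct (½ ℚ.* ε) (half-pos 0<ε)
  ... | M , hM | N , hN = M ℕ.⊔ N , λ m n M⊔N≤m M⊔N≤n → begin-strict
    ℚ.∣ (s m ℚ.+ t m) ℚ.- (s n ℚ.+ t n) ∣
      ≡⟨ cong ℚ.∣_∣ (solve 4 (λ a b c d →
           (a :+ b) :- (c :+ d) := (a :- c) :+ (b :- d))
           refl (s m) (t m) (s n) (t n)) ⟩
    ℚ.∣ (s m ℚ.- s n) ℚ.+ (t m ℚ.- t n) ∣
      ≤⟨ ℚ.∣p+q∣≤∣p∣+∣q∣ (s m ℚ.- s n) (t m ℚ.- t n) ⟩
    ℚ.∣ s m ℚ.- s n ∣ ℚ.+ ℚ.∣ t m ℚ.- t n ∣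
      <⟨ ℚ.+-mono-<
           (hM m n (ℕ.m⊔n≤o⇒m≤o M N M⊔N≤m) (ℕ.m⊔n≤o⇒m≤o M N M⊔N≤n))
           (hN m n (ℕ.m⊔n≤o⇒n≤o M N M⊔N≤m) (ℕ.m⊔n≤o⇒n≤o M N M⊔N≤n)) ⟩
    ½ ℚ.* ε ℚ.+ ½ ℚ.* ε
      ≡⟨ half+half ε ⟩
    ε ∎

  neg-isCauchy : ∀ {s} → IsCauchy s → IsCauchy (λ n → ℚ.- s n)
  neg-isCauchy {s} cs ε 0<ε with cs ε 0<ε
  ... | N , h = N , λ m n N≤m N≤n →
    subst (ℚ._< ε)
      (trans (∣-∣-swap (s m) (s n)) (cong ℚ.∣_∣
        (solve 2 (λ a b → b :- a := :- a :- :- b) refl (s m) (s n))))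
      (h m n N≤m N≤n)

  0<1 : 0ℚ ℚ.< 1ℚ
  0<1 = ℚ.positive⁻¹ 1ℚ

  EventuallyBounded : (ℕ → ℚ) → Set
  EventuallyBounded s =
    ∃ λ B → 0ℚ ℚ.< B × ∃ λ N → ∀ n → N ℕ.≤ n → ℚ.∣ s n ∣ ℚ.≤ B

  bounded : ∀ {s} → IsCauchy s → EventuallyBounded s
  bounded {s} cs with cs 1ℚ 0<1
  ... | N , h =
    1ℚ ℚ.+ ℚ.∣ s N ∣ ,
    ℚ.+-mono-<-≤ 0<1 (ℚ.0≤∣p∣ (s N)) ,
    N , λ n N≤n → begin
    ℚ.∣ s n ∣
      ≡⟨ cong ℚ.∣_∣ (solve 2 (λ a b → a := (a :- b) :+ b) refl (s n) (s N)) ⟩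
    ℚ.∣ (s n ℚ.- s N) ℚ.+ s N ∣
      ≤⟨ ℚ.∣p+q∣≤∣p∣+∣q∣ (s n ℚ.- s N) (s N) ⟩
    ℚ.∣ s n ℚ.- s N ∣ ℚ.+ ℚ.∣ s N ∣
      ≤⟨ ℚ.+-monoˡ-≤ ℚ.∣ s N ∣ (ℚ.<⇒≤ (h n N N≤n ℕ.≤-refl)) ⟩
    1ℚ ℚ.+ ℚ.∣ s N ∣ ∎

  -- |p|≤A, |q|<δ ⇒ |p q| ≤ A |q| < A δ
  ∣p*q∣< : ∀ {A δ} p q → 0ℚ ℚ.< A → ℚ.∣ p ∣ ℚ.≤ A → ℚ.∣ q ∣ ℚ.< δ →
           ℚ.∣ p ℚ.* q ∣ ℚ.< A ℚ.* δ
  ∣p*q∣< {A} {δ} p q 0<A ∣p∣≤A ∣q∣<δ = begin-strict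
    ℚ.∣ p ℚ.* q ∣
      ≡⟨ ℚ.∣p*q∣≡∣p∣*∣q∣ p q ⟩
    ℚ.∣ p ∣ ℚ.* ℚ.∣ q ∣
      ≤⟨ ℚ.*-monoʳ-≤-nonNeg ℚ.∣ q ∣ {{ℚ.∣-∣-nonNeg q}} ∣p∣≤A ⟩
    A ℚ.* ℚ.∣ q ∣
      <⟨ ℚ.*-monoʳ-<-pos A {{ℚ.positive 0<A}} ∣q∣<δ ⟩
    A ℚ.* δ ∎

  -- s m t m − s n t n = s m (t m − t n) + t n (s m − s n), with each
  -- difference below δ = ε / (A + B).
  *-isCauchy′ : ∀ {s t} → IsCauchy s → IsCauchy t →
                EventuallyBounded s → EventuallyBounded t →
                IsCauchy (λ n → s n ℚ.* t n)
  *-isCauchy′ {s} {t} cs ct (A , 0<A , M₁ , hA) (B , 0<B , N₁ , hB) ε 0<ε =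
    K , λ m n K≤m K≤n → begin-strict
    ℚ.∣ s m ℚ.* t m ℚ.- s n ℚ.* t n ∣
      ≡⟨ cong ℚ.∣_∣ (solve 4 (λ a b c d →
           a :* b :- c :* d := a :* (b :- d) :+ d :* (a :- c))
           refl (s m) (t m) (s n) (t n)) ⟩
    ℚ.∣ s m ℚ.* (t m ℚ.- t n) ℚ.+ t n ℚ.* (s m ℚ.- s n) ∣
      ≤⟨ ℚ.∣p+q∣≤∣p∣+∣q∣ (s m ℚ.* (t m ℚ.- t n)) (t n ℚ.* (s m ℚ.- s n)) ⟩
    ℚ.∣ s m ℚ.* (t m ℚ.- t n) ∣ ℚ.+ ℚ.∣ t n ℚ.* (s m ℚ.- s n) ∣
      <⟨ ℚ.+-mono-<
           (∣p*q∣< (s m) (t m ℚ.- t n) 0<A (hA m (M₁≤ K≤m)) (proj₂ Nₜ m n (N₂≤ K≤m) (N₂≤ K≤n)))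
           (∣p*q∣< (t n) (s m ℚ.- s n) 0<B (hB n (N₁≤ K≤n)) (proj₂ Nₛ m n (M₂≤ K≤m) (M₂≤ K≤n))) ⟩
    A ℚ.* δ ℚ.+ B ℚ.* δ
      ≡⟨ solve 4 (λ a b e r → a :* (e :* r) :+ b :* (e :* r) := e :* ((a :+ b) :* r))
           refl A B ε r ⟩
    ε ℚ.* ((A ℚ.+ B) ℚ.* r)
      ≡⟨ cong (ε ℚ.*_) (ℚ.*-inverseʳ (A ℚ.+ B) {{A+B≢0}}) ⟩
    ε ℚ.* 1ℚ
      ≡⟨ ℚ.*-identityʳ ε ⟩
    ε ∎
    where
    0<A+B : 0ℚ ℚ.< A ℚ.+ B
    0<A+B = ℚ.+-mono-< 0<A 0<B

    A+B≢0 : ℚ.NonZero (A ℚ.+ B)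
    A+B≢0 = ℚ.>-nonZero 0<A+B

    r δ : ℚ
    r = (ℚ.1/ (A ℚ.+ B)) {{A+B≢0}}
    δ = ε ℚ.* r

    0<r : ℚ.Positive r
    0<r = ℚ.1/pos⇒pos (A ℚ.+ B) {{ℚ.positive 0<A+B}}

    0<δ : 0ℚ ℚ.< δ
    0<δ = ℚ.positive⁻¹ δ {{ℚ.pos*pos⇒pos ε {{ℚ.positive 0<ε}} r {{0<r}}}}

    Nₛ : ∃ λ N → ∀ m n → N ℕ.≤ m → N ℕ.≤ n → ℚ.∣ s m ℚ.- s n ∣ ℚ.< δ
    Nₛ = cs δ 0<δ

    Nₜ : ∃ λ N → ∀ m n → N ℕ.≤ m → N ℕ.≤ n → ℚ.∣ t m ℚ.- t n ∣ ℚ.< δ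
    Nₜ = ct δ 0<δ

    M₂ N₂ K : ℕ
    M₂ = proj₁ Nₛ
    N₂ = proj₁ Nₜ
    K = (M₁ ℕ.⊔ N₁) ℕ.⊔ (M₂ ℕ.⊔ N₂)

    M₁≤ : ∀ {k} → K ℕ.≤ k → M₁ ℕ.≤ k
    M₁≤ h = ℕ.m⊔n≤o⇒m≤o M₁ N₁ (ℕ.m⊔n≤o⇒m≤o (M₁ ℕ.⊔ N₁) (M₂ ℕ.⊔ N₂) h)
    N₁≤ : ∀ {k} → K ℕ.≤ k → N₁ ℕ.≤ k
    N₁≤ h = ℕ.m⊔n≤o⇒n≤o M₁ N₁ (ℕ.m⊔n≤o⇒m≤o (M₁ ℕ.⊔ N₁) (M₂ ℕ.⊔ N₂) h)
    M₂≤ : ∀ {k} → K ℕ.≤ k → M₂ ℕ.≤ k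
    M₂≤ h = ℕ.m⊔n≤o⇒m≤o M₂ N₂ (ℕ.m⊔n≤o⇒n≤o (M₁ ℕ.⊔ N₁) (M₂ ℕ.⊔ N₂) h)
    N₂≤ : ∀ {k} → K ℕ.≤ k → N₂ ℕ.≤ k
    N₂≤ h = ℕ.m⊔n≤o⇒n≤o M₂ N₂ (ℕ.m⊔n≤o⇒n≤o (M₁ ℕ.⊔ N₁) (M₂ ℕ.⊔ N₂) h)

  *-isCauchy : ∀ {s t} → IsCauchy s → IsCauchy t →
               IsCauchy (λ n → s n ℚ.* t n)
  *-isCauchy {s} {t} cs ct = *-isCauchy′ {s} {t} cs ct (bounded cs) (bounded ct)

infix  8 -_
infixl 7 _*_
infixl 6 _+_ _-_

_+_ : ℝ → ℝ → ℝ
x + y = mkℝ (λ n → seq x n ℚ.+ seq y n) (+-isCauchy {seq x} {seq y} (isCauchy x) (isCauchy y))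

-_ : ℝ → ℝ
- x = mkℝ (λ n → ℚ.- seq x n) (neg-isCauchy {seq x} (isCauchy x))

_-_ : ℝ → ℝ → ℝ
x - y = x + (- y)

_*_ : ℝ → ℝ → ℝ
x * y = mkℝ (λ n → seq x n ℚ.* seq y n) (*-isCauchy {seq x} {seq y} (isCauchy x) (isCauchy y))

fromℚ : ℚ → ℝ
fromℚ q = mkℝ (λ _ → q) (λ ε 0<ε → 0 , λ _ _ _ _ → ∣p-p∣<ε q 0<ε)

fromℤ : ℤ → ℝ
fromℤ k = fromℚ (k ℚ./ 1)

0ℝ : ℝ
0ℝ = fromℚ 0ℚ

≈-refl : ∀ {x} → x ≈ x
≈-refl {x} ε 0<ε = 0 , λ n _ → ∣p-p∣<ε (seq x n) 0<ε

≈-sym : ∀ {x y} → x ≈ y → y ≈ x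
≈-sym {x} {y} x≈y ε 0<ε = map₂
  (λ h n N≤n → subst (ℚ._< ε) (∣-∣-swap (seq x n) (seq y n)) (h n N≤n))
  (x≈y ε 0<ε)

Point : Set
Point = ℝ × ℝ

infix 4 _≈ₚ_

_≈ₚ_ : Point → Point → Set
(x₁ , y₁) ≈ₚ (x₂ , y₂) = x₁ ≈ x₂ × y₁ ≈ y₂

-- d is the non-negative square root of (x₁ - x₂)² + (y₁ - y₂)².
IsDistance : Point → Point → ℝ → Set
IsDistance (x₁ , y₁) (x₂ , y₂) d =
  0ℝ ≤ d × d * d ≈ (x₁ - x₂) * (x₁ - x₂) + (y₁ - y₂) * (y₁ - y₂)

Odd : ℤ → Set
Odd k = ∃ λ m → k ≡ ℤ.+ 2 ℤ.* m ℤ.+ ℤ.+ 1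

OddDistance : Point → Point → Set
OddDistance p q = ∃ λ k → Odd k × IsDistance p q (fromℤ k)

-- A finite subset of the plane, listed without repetition; the graph on it
-- then has vertex set Fin size, and colourings need not mention _≈ₚ_.
record FinitePointSet : Set where
  field
    size     : ℕ
    point    : Fin size → Point
    distinct : ∀ i j → point i ≈ₚ point j → i ≡ j

record SimpleGraph (V : Set) : Set₁ where
  field
    Adj    : V → V → Set
    symm   : Symmetric Adj
    irrefl : Irreflexive _≡_ Adj

record Colouring {V : Set} (G : SimpleGraph V) (k : ℕ) : Set where
  open SimpleGraph G
  field
    colour : V → Fin k
    proper : ∀ u v → Adj u v → colour u ≢ colour v

HasChromaticNumber : {V : Set} → SimpleGraph V → ℕ → Set
HasChromaticNumber G k = Colouring G k × (∀ j → Colouring G j → k ℕ.≤ j)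

private

  OddDistance-sym : Symmetric OddDistance
  OddDistance-sym {x₁ , y₁} {x₂ , y₂} (k , odd , 0≤k , k²≈) =
    k , odd , 0≤k , λ ε 0<ε → map₂
      (λ h n N≤n → subst (λ r → ℚ.∣ (k ℚ./ 1) ℚ.* (k ℚ./ 1) ℚ.- r ∣ ℚ.< ε)
        (solve 4 (λ a b c d →
          (a :- c) :* (a :- c) :+ (b :- d) :* (b :- d) :=
          (c :- a) :* (c :- a) :+ (d :- b) :* (d :- b))
          refl (seq x₁ n) (seq y₁ n) (seq x₂ n) (seq y₂ n))
        (h n N≤n))
      (k²≈ ε 0<ε)

oddDistanceGraph : (S : FinitePointSet) → SimpleGraph (Fin (FinitePointSet.size S))
oddDistanceGraph S = record
  { Adj    = λ i j → ¬ (point i ≈ₚ point j) × OddDistance (point i) (point j)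
  ; symm   = λ {i} {j} (i≉j , odd) →
      (λ (ex , ey) → i≉j (≈-sym {proj₁ (point j)} {proj₁ (point i)} ex
                        , ≈-sym {proj₂ (point j)} {proj₂ (point i)} ey)) ,
      OddDistance-sym {point i} {point j} odd
  ; irrefl = λ { {i} refl (i≉i , _) →
      i≉i (≈-refl {proj₁ (point i)} , ≈-refl {proj₂ (point i)}) }
  }
  where open FinitePointSet S

{-# OPTIONS --safe #-}

-- Let α = (1 + √-7)/2 and zᵢ = αⁱ ᾱ¹⁶⁻ⁱ / 2⁸ for 0 ≤ i ≤ 16, seventeen complex
-- numbers of modulus 1.  If all points at odd distance get different colours,
-- then along any line x + ℤ zᵢ no colour occurs at places of both parities, so
-- the alternating sum of the indicator f of a colour class along the line is,
-- up to sign, its plain sum.  Averaging over a large torus and summing over k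
-- colours, the operators aᵢ = Σⱼ (-1)ʲ (shift by j zᵢ), with n terms, satisfy
-- Σ |aᵢ f|² ≥ (17/k) n² Σ |f|², up to boundary terms.  Conversely, aᵢ f / n nearly
-- projects on the functions negated by the shift by zᵢ.  Any three of the zᵢ
-- satisfy an integral relation with odd coefficient sum (because 2 = α ᾱ splits),
-- so no function is negated by all three of these shifts: triple products of the
-- aᵢ are negligible.  Then Σ |aᵢ f|² ≤ 3 n² |f|² up to small terms, which is absurd
-- for k = 5.  So a large grid is not 5-colourable, and among its subsets obtained
-- by dropping points one by one there is one of chromatic number exactly 6.

module Submission where

open import Data.Bool.Base using (if_then_else_)
open import Data.Fin.Base using (Fin; zero; suc; toℕ; fromℕ; inject₁; inject≤; combine; remQuot)
open import Data.Fin.Permutation using (permutation)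
import Data.Fin.Properties as Fin
open import Data.Integer.Base as ℤ using (ℤ; +_; -[1+_]; 0ℤ; 1ℤ; -1ℤ)
import Data.Integer.Properties as ℤ
import Data.Integer.Solver
open import Data.List.Base using (List; []; _∷_; length; map)
open import Data.List.Properties using (length-map)
open import Data.List.Relation.Unary.All as All using (All; []; _∷_)
import Data.List.Relation.Unary.All.Properties as All
open import Data.List.Relation.Unary.AllPairs as AllPairs using (AllPairs; []; _∷_)
import Data.List.Relation.Unary.AllPairs.Properties as AllPairs
open import Data.Nat.Base as ℕ using (ℕ; zero; suc; NonZero; parity)
open import Data.Nat.DivMod
  using (_%_; _/_; _mod_; m%n<n; m%n%n≡m%n; %-distribˡ-+; [m+kn]%n≡m%n; m<n⇒m%n≡m; m≡m%n+[m/n]*n)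
import Data.Nat.Properties as ℕ
import Data.Nat.Solver
open import Data.Parity.Base using (0ℙ; 1ℙ)
import Data.Parity.Properties as ℙ
open import Data.Product.Base using (∃; ∃-syntax; _×_; _,_; proj₁; proj₂; uncurry)
open import Data.Rational.Base as ℚ using (ℚ; 0ℚ; 1ℚ; ½; mkℚ; toℚᵘ; ↥_; ↧_; ↧ₙ_)
import Data.Rational.Properties as ℚ
import Data.Rational.Solver
open import Data.Rational.Unnormalised.Base as ℚᵘ using (mkℚᵘ; *≡*)
import Data.Rational.Unnormalised.Properties as ℚᵘ
open import Data.Sum.Base using (inj₁; inj₂)
open import Data.Unit.Base using (tt)
import Data.Vec.Functional as Vector
open import Defs hiding (_+_; _*_; _-_; -_; _≤_)
open import Function.Base using (_∘_; case_of_)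
open import Relation.Binary.PropositionalEquality
  using (_≡_; _≢_; _≗_; refl; sym; trans; cong; cong₂; subst; subst₂; module ≡-Reasoning)
open import Relation.Nullary using (Dec; yes; no; contradiction; ¬_; does)
open import Relation.Nullary.Decidable
  using (map′; _×-dec_; _→-dec_; ¬?; toWitness; toWitnessFalse; from-yes)

-- The odd coefficient sum: let i < j < k and a zᵢ + b zⱼ + c zₖ = 0 with integers a, b, c not all
-- even. After division by the common powers of α and ᾱ, only the first of the three numbers is
-- prime to α and only the last to ᾱ. So α divides a and ᾱ divides c; these integers are then even,
-- b is odd, and so is a + b + c. The constant 3: let Pᵢ = aᵢ* aᵢ / n² up to rounding, S = Σ Pᵢ, and
-- E₂, E₃ the sums of products over pairs and triples. From Pᵢ² ≤ Pᵢ follows S² ≤ S + 2 E₂, and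
-- completing squares gives E₂ ≤ S + 2 E₃. With E₃ negligible, S² ≤ 3 S, so S ≤ 3 < 17/5.
-- Denominators are cleared and norms stay squared, so all of this happens over ℤ without spectral
-- theory. The torus makes shifts exact isometries, but a line that wraps around need not alternate;
-- this is the boundary term. Dropping points needs a case distinction on colourability, which must
-- be decidable. Hence odd distance between real points is first turned into an equation between
-- integers.

private
  module ℕS = Data.Nat.Solver.+-*-Solver
  module ℤS = Data.Integer.Solver.+-*-Solver

-- Odd distances between lattice points, reduced to integer arithmetic

module OddDistances where

  open Data.Rational.Solver.+-*-Solver using (solve; _:+_; _:*_; _:-_; _:=_; :-_; con)

  -- Integers as rationals

  ι : ℤ → ℚ
  ι i = i ℚ./ 1

  toℚᵘ-ι : ∀ i → toℚᵘ (ι i) ℚᵘ.≃ mkℚᵘ i 0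
  toℚᵘ-ι i = ℚ.toℚᵘ-fromℚᵘ (mkℚᵘ i 0)

  ι-+ : ∀ i j → ι (i ℤ.+ j) ≡ ι i ℚ.+ ι j
  ι-+ i j = ℚ.toℚᵘ-injective (begin-equality
    toℚᵘ (ι (i ℤ.+ j))               ≃⟨ toℚᵘ-ι (i ℤ.+ j) ⟩
    mkℚᵘ (i ℤ.+ j) 0                 ≃⟨ *≡* (ℤS.solve 2 (λ i j → (i ℤS.:+ j) ℤS.:* ℤS.con 1ℤ ℤS.:= (i ℤS.:* ℤS.con 1ℤ ℤS.:+ j ℤS.:* ℤS.con 1ℤ) ℤS.:* ℤS.con 1ℤ) refl i j) ⟩
    mkℚᵘ i 0 ℚᵘ.+ mkℚᵘ j 0           ≃⟨ ℚᵘ.+-cong (toℚᵘ-ι i) (toℚᵘ-ι j) ⟨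
    toℚᵘ (ι i) ℚᵘ.+ toℚᵘ (ι j)       ≃⟨ ℚ.toℚᵘ-homo-+ (ι i) (ι j) ⟨
    toℚᵘ (ι i ℚ.+ ι j)               ∎)
    where open ℚᵘ.≤-Reasoning

  ι-* : ∀ i j → ι (i ℤ.* j) ≡ ι i ℚ.* ι j
  ι-* i j = ℚ.toℚᵘ-injective (begin-equality
    toℚᵘ (ι (i ℤ.* j))               ≃⟨ toℚᵘ-ι (i ℤ.* j) ⟩
    mkℚᵘ i 0 ℚᵘ.* mkℚᵘ j 0           ≃⟨ ℚᵘ.*-cong (toℚᵘ-ι i) (toℚᵘ-ι j) ⟨
    toℚᵘ (ι i) ℚᵘ.* toℚᵘ (ι j)       ≃⟨ ℚ.toℚᵘ-homo-* (ι i) (ι j) ⟨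
    toℚᵘ (ι i ℚ.* ι j)               ∎)
    where open ℚᵘ.≤-Reasoning

  ι-neg : ∀ i → ι (ℤ.- i) ≡ ℚ.- ι i
  ι-neg i = ℚ.toℚᵘ-injective (begin-equality
    toℚᵘ (ι (ℤ.- i))     ≃⟨ toℚᵘ-ι (ℤ.- i) ⟩
    ℚᵘ.- mkℚᵘ i 0        ≃⟨ ℚᵘ.-‿cong (toℚᵘ-ι i) ⟨
    ℚᵘ.- toℚᵘ (ι i)      ≃⟨ ℚ.toℚᵘ-homo‿- (ι i) ⟨
    toℚᵘ (ℚ.- ι i)       ∎)
    where open ℚᵘ.≤-Reasoning

  ι-- : ∀ i j → ι (i ℤ.- j) ≡ ι i ℚ.- ι j
  ι-- i j = trans (ι-+ i (ℤ.- j)) (cong (ι i ℚ.+_) (ι-neg j))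

  ι-injective : ∀ {i j} → ι i ≡ ι j → i ≡ j
  ι-injective {i} {j} eq with ℚ./-injective-≃ (mkℚᵘ i 0) (mkℚᵘ j 0) eq
  ... | *≡* i*1≡j*1 = ℤ.*-cancelʳ-≡ i j 1ℤ i*1≡j*1

  ι-mono-≤ : ∀ {i j} → i ℤ.≤ j → ι i ℚ.≤ ι j
  ι-mono-≤ {i} {j} i≤j = ℚ.toℚᵘ-cancel-≤ (begin
    toℚᵘ (ι i)   ≃⟨ toℚᵘ-ι i ⟩
    mkℚᵘ i 0     ≤⟨ ℚᵘ.*≤* (ℤ.*-monoʳ-≤-nonNeg 1ℤ i≤j) ⟩
    mkℚᵘ j 0     ≃⟨ toℚᵘ-ι j ⟨
    toℚᵘ (ι j)   ∎)
    where open ℚᵘ.≤-Reasoning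

  *-denominator : ∀ p → p ℚ.* ι (↧ p) ≡ ι (↥ p)
  *-denominator p@record{} = ℚ.toℚᵘ-injective (begin-equality
    toℚᵘ (p ℚ.* ι (↧ p))              ≃⟨ ℚ.toℚᵘ-homo-* p (ι (↧ p)) ⟩
    toℚᵘ p ℚᵘ.* toℚᵘ (ι (↧ p))        ≃⟨ ℚᵘ.*-congˡ {toℚᵘ p} (toℚᵘ-ι (↧ p)) ⟩
    toℚᵘ p ℚᵘ.* mkℚᵘ (↧ p) 0          ≃⟨ *≡* (trans (ℤ.*-identityʳ (↥ p ℤ.* ↧ p))
                                             (cong (↥ p ℤ.*_) (sym (cong +_ (ℕ.*-identityʳ (↧ₙ p)))))) ⟩
    mkℚᵘ (↥ p) 0                      ≃⟨ toℚᵘ-ι (↥ p) ⟨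
    toℚᵘ (ι (↥ p))                    ∎)
    where open ℚᵘ.≤-Reasoning

  -- Small rationals

  ∣p∣<ε : ∀ {p ε} → p ℚ.< ε → ℚ.- p ℚ.< ε → ℚ.∣ p ∣ ℚ.< ε
  ∣p∣<ε {p} {ε} p<ε -p<ε with ℚ.∣p∣≡p∨∣p∣≡-p p
  ... | inj₁ eq = subst (ℚ._< ε) (sym eq) p<ε
  ... | inj₂ eq = subst (ℚ._< ε) (sym eq) -p<ε

  infinitesimal : ∀ q → (∀ ε → 0ℚ ℚ.< ε → ℚ.∣ q ∣ ℚ.< ε) → q ≡ 0ℚ
  infinitesimal q small with ℚ.∣ q ∣ ℚ.≟ 0ℚ
  ... | yes ∣q∣≡0 = ℚ.∣p∣≡0⇒p≡0 q ∣q∣≡0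
  ... | no  ∣q∣≢0 = contradiction (small ℚ.∣ q ∣ (ℚ.≰⇒> (λ ∣q∣≤0 → ∣q∣≢0 (ℚ.≤-antisym ∣q∣≤0 (ℚ.0≤∣p∣ q))))) (ℚ.<-irrefl refl)

  *-pos : ∀ {p q} → 0ℚ ℚ.< p → 0ℚ ℚ.< q → 0ℚ ℚ.< p ℚ.* q
  *-pos {p} {q} 0<p 0<q = ℚ.positive⁻¹ (p ℚ.* q) {{ℚ.pos*pos⇒pos p {{ℚ.positive 0<p}} q {{ℚ.positive 0<q}}}}

  *-nonNeg : ∀ {p q} → 0ℚ ℚ.≤ p → 0ℚ ℚ.≤ q → 0ℚ ℚ.≤ p ℚ.* q
  *-nonNeg {p} {q} 0≤p 0≤q =
    ℚ.nonNegative⁻¹ (p ℚ.* q) {{ℚ.nonNeg*nonNeg⇒nonNeg p {{ℚ.nonNegative 0≤p}} q {{ℚ.nonNegative 0≤q}}}}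

  square-cancel-< : ∀ {p q} → 0ℚ ℚ.≤ q → p ℚ.* p ℚ.< q ℚ.* q → p ℚ.< q
  square-cancel-< {p} {q} 0≤q p²<q² with p ℚ.<? q
  ... | yes p<q = p<q
  ... | no  p≮q = contradiction (begin-strict
    p ℚ.* p <⟨ p²<q² ⟩
    q ℚ.* q ≤⟨ ℚ.*-monoˡ-≤-nonNeg q {{ℚ.nonNegative 0≤q}} q≤p ⟩
    q ℚ.* p ≤⟨ ℚ.*-monoʳ-≤-nonNeg p {{ℚ.nonNegative (ℚ.≤-trans 0≤q q≤p)}} q≤p ⟩
    p ℚ.* p ∎) (ℚ.<-irrefl refl)
    where
    open ℚ.≤-Reasoning
    q≤p : q ℚ.≤ p
    q≤p = ℚ.≮⇒≥ p≮q

  width : ℕ → ℚ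
  width zero    = 1ℚ
  width (suc n) = ½ ℚ.* width n

  0<width : ∀ n → 0ℚ ℚ.< width n
  0<width zero    = ℚ.positive⁻¹ 1ℚ
  0<width (suc n) = *-pos (ℚ.positive⁻¹ ½) (0<width n)

  half : ∀ p → ½ ℚ.* p ℚ.+ ½ ℚ.* p ≡ p
  half p = trans (sym (ℚ.*-distribʳ-+ p ½ ½)) (ℚ.*-identityˡ p)

  width-suc≤ : ∀ n → width (suc n) ℚ.≤ width n
  width-suc≤ n = subst₂ ℚ._≤_ (ℚ.+-identityʳ (width (suc n))) (half (width n))
    (ℚ.+-monoʳ-≤ (width (suc n)) (ℚ.<⇒≤ (0<width (suc n))))

  width-antitone : ∀ {m n} → m ℕ.≤ n → width n ℚ.≤ width m
  width-antitone m≤n = go (ℕ.≤⇒≤′ m≤n)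
    where
    go : ∀ {m n} → m ℕ.≤′ n → width n ℚ.≤ width m
    go (ℕ.≤′-reflexive refl) = ℚ.≤-refl
    go (ℕ.≤′-step {n} m≤′n)  = ℚ.≤-trans (width-suc≤ n) (go m≤′n)

  width*suc≤1 : ∀ n → width n ℚ.* ι (+ suc n) ℚ.≤ 1ℚ
  width*suc≤1 zero    = ℚ.≤-refl
  width*suc≤1 (suc n) = begin
    ½ ℚ.* width n ℚ.* ι (+ suc (suc n))
      ≤⟨ ℚ.*-monoˡ-≤-nonNeg (½ ℚ.* width n) {{ℚ.nonNegative (ℚ.<⇒≤ (0<width (suc n)))}}
           (ι-mono-≤ {+ suc (suc n)} {+ suc n ℤ.+ + suc n} (ℤ.+≤+ (ℕ.s≤s (ℕ.m≤n+m (suc n) n)))) ⟩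
    ½ ℚ.* width n ℚ.* ι (+ suc n ℤ.+ + suc n)
      ≡⟨ cong (½ ℚ.* width n ℚ.*_) (ι-+ (+ suc n) (+ suc n)) ⟩
    ½ ℚ.* width n ℚ.* (ι (+ suc n) ℚ.+ ι (+ suc n))
      ≡⟨ solve 3 (λ h w s → h :* w :* (s :+ s) := (h :* w :+ h :* w) :* s) refl ½ (width n) (ι (+ suc n)) ⟩
    (½ ℚ.* width n ℚ.+ ½ ℚ.* width n) ℚ.* ι (+ suc n)
      ≡⟨ cong (ℚ._* ι (+ suc n)) (half (width n)) ⟩
    width n ℚ.* ι (+ suc n)
      ≤⟨ width*suc≤1 n ⟩
    1ℚ ∎
    where open ℚ.≤-Reasoning

  width<ε : ∀ ε → 0ℚ ℚ.< ε → ∃ λ N → width N ℚ.< ε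
  width<ε ε@(mkℚ (+ zero) d-1 _) 0<ε = contradiction 0<ε λ { (ℚ.*<* (ℤ.+<+ ())) }
  width<ε ε@(mkℚ -[1+ _ ] d-1 _) 0<ε = contradiction 0<ε λ { (ℚ.*<* ()) }
  -- With denominator d = `suc d-1`, ε is at least 1/d, while 2⁻ᵈ ≤ 1/(d + 1) is strictly smaller.
  width<ε ε@(mkℚ (+ suc p) d-1 _) 0<ε = suc d-1 ,
    ℚ.*-cancelʳ-<-nonNeg (ι (+ suc (suc d-1))) {{ℚ.nonNegative (ι-mono-≤ {0ℤ} {+ suc (suc d-1)} (ℤ.+≤+ ℕ.z≤n))}} (begin-strict
      width (suc d-1) ℚ.* ι (+ suc (suc d-1)) ≤⟨ width*suc≤1 (suc d-1) ⟩
      1ℚ                                      ≤⟨ ι-mono-≤ {1ℤ} {+ suc p} (ℤ.+≤+ (ℕ.s≤s ℕ.z≤n)) ⟩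
      ι (+ suc p)                             ≡⟨ *-denominator ε ⟨
      ε ℚ.* ι (+ suc d-1)                     ≡⟨ ℚ.+-identityʳ _ ⟨
      ε ℚ.* ι (+ suc d-1) ℚ.+ 0ℚ              <⟨ ℚ.+-monoʳ-< (ε ℚ.* ι (+ suc d-1)) 0<ε ⟩
      ε ℚ.* ι (+ suc d-1) ℚ.+ ε               ≡⟨ solve 2 (λ e d → e :* d :+ e := e :* (d :+ con 1ℚ)) refl ε (ι (+ suc d-1)) ⟩
      ε ℚ.* (ι (+ suc d-1) ℚ.+ ι 1ℤ)          ≡⟨ cong (ε ℚ.*_) (ι-+ (+ suc d-1) 1ℤ) ⟨
      ε ℚ.* ι (+ (suc d-1 ℕ.+ 1))             ≡⟨ cong (λ m → ε ℚ.* ι (+ m)) (ℕ.+-comm (suc d-1) 1) ⟩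
      ε ℚ.* ι (+ suc (suc d-1))               ∎)
    where open ℚ.≤-Reasoning

  -- The square root of 7, by bisection

  7ℚ : ℚ
  7ℚ = + 7 ℚ./ 1

  2ℚ 3ℚ : ℚ
  2ℚ = + 2 ℚ./ 1
  3ℚ = + 3 ℚ./ 1

  bisect : ℚ → ℚ → ℚ
  bisect l w with (l ℚ.+ w) ℚ.* (l ℚ.+ w) ℚ.≤? 7ℚ
  ... | yes _ = l ℚ.+ w
  ... | no  _ = l

  lower : ℕ → ℚ
  lower zero    = 2ℚ
  lower (suc n) = bisect (lower n) (width (suc n))

  record Brackets (l w : ℚ) : Set where
    field
      2≤l : 2ℚ ℚ.≤ l
      l²≤7 : l ℚ.* l ℚ.≤ 7ℚ
      7<u² : 7ℚ ℚ.< (l ℚ.+ w) ℚ.* (l ℚ.+ w)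

  open Brackets

  bisect-brackets : ∀ {l w} → 0ℚ ℚ.< w → Brackets l (w ℚ.+ w) → Brackets (bisect l w) w
  bisect-brackets {l} {w} 0<w br with (l ℚ.+ w) ℚ.* (l ℚ.+ w) ℚ.≤? 7ℚ
  ... | yes m²≤7 = record
    { 2≤l  = ℚ.≤-trans (2≤l br) (subst (ℚ._≤ l ℚ.+ w) (ℚ.+-identityʳ l) (ℚ.+-monoʳ-≤ l (ℚ.<⇒≤ 0<w)))
    ; l²≤7 = m²≤7
    ; 7<u² = subst (λ u → 7ℚ ℚ.< u ℚ.* u) (sym (ℚ.+-assoc l w w)) (7<u² br) }
  ... | no m²≰7 = record { 2≤l = 2≤l br ; l²≤7 = l²≤7 br ; 7<u² = ℚ.≰⇒> m²≰7 }

  brackets : ∀ n → Brackets (lower n) (width n)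
  brackets zero    = record
    { 2≤l  = ℚ.≤-refl
    ; l²≤7 = ι-mono-≤ {+ 4} {+ 7} (ℤ.+≤+ (ℕ.m≤m+n 4 3))
    ; 7<u² = ℚ.*<* (ℤ.+<+ (ℕ.m≤m+n 8 1)) }
  brackets (suc n) = bisect-brackets (0<width (suc n))
    (subst (Brackets (lower n)) (sym (half (width n))) (brackets n))

  0≤lower : ∀ n → 0ℚ ℚ.≤ lower n
  0≤lower n = ℚ.≤-trans (ι-mono-≤ {0ℤ} {+ 2} (ℤ.+≤+ ℕ.z≤n)) (2≤l (brackets n))

  0≤lower+width : ∀ n → 0ℚ ℚ.≤ lower n ℚ.+ width n
  0≤lower+width n = ℚ.+-mono-≤ (0≤lower n) (ℚ.<⇒≤ (0<width n))

  -- The squares lie on the two sides of 7. As m and n are independent, this gives the Cauchy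
  -- property directly, without monotonicity of `lower`.
  lower<upper : ∀ m n → lower m ℚ.< lower n ℚ.+ width n
  lower<upper m n = square-cancel-< (0≤lower+width n)
    (ℚ.≤-<-trans (l²≤7 (brackets m)) (7<u² (brackets n)))

  lower-lower<ε : ∀ {N ε} m n → width N ℚ.< ε → N ℕ.≤ n → lower m ℚ.- lower n ℚ.< ε
  lower-lower<ε {N} {ε} m n w<ε N≤n = begin-strict
    lower m ℚ.- lower n                 <⟨ ℚ.+-monoˡ-< (ℚ.- lower n) (lower<upper m n) ⟩
    lower n ℚ.+ width n ℚ.- lower n     ≡⟨ solve 2 (λ l w → l :+ w :- l := w) refl (lower n) (width n) ⟩
    width n                             ≤⟨ width-antitone N≤n ⟩
    width N                             <⟨ w<ε ⟩
    ε                                   ∎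
    where open ℚ.≤-Reasoning

  √7 : ℝ
  √7 = mkℝ lower λ ε 0<ε → let (N , w<ε) = width<ε ε 0<ε in
    N , λ m n N≤m N≤n → ∣p∣<ε (lower-lower<ε m n w<ε N≤n)
      (subst (ℚ._< ε) (solve 2 (λ a b → b :- a := :- (a :- b)) refl (lower m) (lower n))
        (lower-lower<ε n m w<ε N≤m))

  0≤7-lower² : ∀ n → 0ℚ ℚ.≤ 7ℚ ℚ.- lower n ℚ.* lower n
  0≤7-lower² n = subst (ℚ._≤ 7ℚ ℚ.- lower n ℚ.* lower n) (ℚ.+-inverseʳ (lower n ℚ.* lower n))
    (ℚ.+-monoˡ-≤ (ℚ.- (lower n ℚ.* lower n)) (l²≤7 (brackets n)))

  -- (l + w)² - l² = w (l + l + w) ≤ 7 w, as l ≤ 3 and w ≤ 1.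
  7-lower²≤ : ∀ n → 7ℚ ℚ.- lower n ℚ.* lower n ℚ.≤ 7ℚ ℚ.* width n
  7-lower²≤ n = begin
    7ℚ ℚ.- l ℚ.* l                            ≤⟨ ℚ.+-monoˡ-≤ (ℚ.- (l ℚ.* l)) (ℚ.<⇒≤ (7<u² (brackets n))) ⟩
    (l ℚ.+ w) ℚ.* (l ℚ.+ w) ℚ.- l ℚ.* l       ≡⟨ solve 2 (λ l w → (l :+ w) :* (l :+ w) :- l :* l := (l :+ l :+ w) :* w) refl l w ⟩
    (l ℚ.+ l ℚ.+ w) ℚ.* w                     ≤⟨ ℚ.*-monoʳ-≤-nonNeg w {{ℚ.nonNegative (ℚ.<⇒≤ (0<width n))}}
                                                   (ℚ.+-mono-≤ (ℚ.+-mono-≤ l≤3 l≤3) (width-antitone {0} {n} ℕ.z≤n)) ⟩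
    7ℚ ℚ.* w                                  ∎
    where
    open ℚ.≤-Reasoning
    l = lower n
    w = width n
    l≤3 : l ℚ.≤ 3ℚ
    l≤3 = ℚ.<⇒≤ (lower<upper n 0)

  -- Points (a / 512 , b √7 / 512)

  Lattice : Set
  Lattice = ℤ × ℤ

  mesh : ℚ
  mesh = + 1 ℚ./ 512

  512*mesh≡1 : ι (+ 512) ℚ.* mesh ≡ 1ℚ
  512*mesh≡1 = refl

  cancel-mesh : ∀ {p q} → p ℚ.* mesh ≡ q ℚ.* mesh → p ≡ q
  cancel-mesh {p} {q} eq = trans (unscale p) (trans (cong (ℚ._* ι (+ 512)) eq) (sym (unscale q)))
    where
    unscale : ∀ r → r ≡ r ℚ.* mesh ℚ.* ι (+ 512)
    unscale r = trans (sym (ℚ.*-identityʳ r)) (trans (cong (r ℚ.*_) (sym 512*mesh≡1))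
      (solve 3 (λ r n h → r :* (n :* h) := r :* h :* n) refl r (ι (+ 512)) mesh))

  embed : Lattice → Point
  embed (a , b) = fromℚ (ι a ℚ.* mesh) , fromℚ (ι b ℚ.* mesh) Defs.* √7

  norm : Lattice → Lattice → ℤ
  norm (a , b) (a′ , b′) = (a ℤ.- a′) ℤ.* (a ℤ.- a′) ℤ.+ + 7 ℤ.* ((b ℤ.- b′) ℤ.* (b ℤ.- b′))

  -- By norm-square below, the points embed P and embed Q are then at distance k.
  OddlyApart : Lattice → Lattice → Set
  OddlyApart P Q = ∃ λ k → parity k ≡ 1ℙ × norm P Q ≡ + (512 ℕ.* k) ℤ.* + (512 ℕ.* k)

  -- Squared distances in this lattice are rational because √7² = 7; this is the deviation caused by
  -- the n-th approximation of √7.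
  error : Lattice → Lattice → ℕ → ℚ
  error (a , b) (a′ , b′) n =
    (ι (b ℤ.- b′) ℚ.* mesh) ℚ.* (ι (b ℤ.- b′) ℚ.* mesh) ℚ.* (7ℚ ℚ.- lower n ℚ.* lower n)

  square-distance : Point → Point → ℝ
  square-distance (x₁ , y₁) (x₂ , y₂) =
    (x₁ Defs.- x₂) Defs.* (x₁ Defs.- x₂) Defs.+ (y₁ Defs.- y₂) Defs.* (y₁ Defs.- y₂)

  square-distance-embed : ∀ P Q n →
    seq (square-distance (embed P) (embed Q)) n ≡ ι (norm P Q) ℚ.* (mesh ℚ.* mesh) ℚ.- error P Q n
  square-distance-embed (a , b) (a′ , b′) n = begin
    (ι a ℚ.* mesh ℚ.- ι a′ ℚ.* mesh) ℚ.* (ι a ℚ.* mesh ℚ.- ι a′ ℚ.* mesh) ℚ.+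
    (ι b ℚ.* mesh ℚ.* s ℚ.- ι b′ ℚ.* mesh ℚ.* s) ℚ.* (ι b ℚ.* mesh ℚ.* s ℚ.- ι b′ ℚ.* mesh ℚ.* s)
      ≡⟨ solve 7 (λ a a′ b b′ h s q →
           (a :* h :- a′ :* h) :* (a :* h :- a′ :* h) :+
           (b :* h :* s :- b′ :* h :* s) :* (b :* h :* s :- b′ :* h :* s) :=
           ((a :- a′) :* (a :- a′) :+ q :* ((b :- b′) :* (b :- b′))) :* (h :* h) :-
           ((b :- b′) :* h) :* ((b :- b′) :* h) :* (q :- s :* s)) refl
           (ι a) (ι a′) (ι b) (ι b′) mesh s 7ℚ ⟩
    ((ι a ℚ.- ι a′) ℚ.* (ι a ℚ.- ι a′) ℚ.+ 7ℚ ℚ.* ((ι b ℚ.- ι b′) ℚ.* (ι b ℚ.- ι b′))) ℚ.* (mesh ℚ.* mesh) ℚ.-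
    ((ι b ℚ.- ι b′) ℚ.* mesh) ℚ.* ((ι b ℚ.- ι b′) ℚ.* mesh) ℚ.* (7ℚ ℚ.- s ℚ.* s)
      ≡⟨ cong₂ (λ Δa Δb → (Δa ℚ.* Δa ℚ.+ 7ℚ ℚ.* (Δb ℚ.* Δb)) ℚ.* (mesh ℚ.* mesh) ℚ.- (Δb ℚ.* mesh) ℚ.* (Δb ℚ.* mesh) ℚ.* (7ℚ ℚ.- s ℚ.* s))
           (ι-- a a′) (ι-- b b′) ⟨
    (ι A ℚ.* ι A ℚ.+ 7ℚ ℚ.* (ι B ℚ.* ι B)) ℚ.* (mesh ℚ.* mesh) ℚ.- error (a , b) (a′ , b′) n
      ≡⟨ cong (λ q → q ℚ.* (mesh ℚ.* mesh) ℚ.- error (a , b) (a′ , b′) n) ι-norm ⟨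
    ι (norm (a , b) (a′ , b′)) ℚ.* (mesh ℚ.* mesh) ℚ.- error (a , b) (a′ , b′) n ∎
    where
    open ≡-Reasoning
    s = lower n
    A = a ℤ.- a′
    B = b ℤ.- b′
    ι-norm : ι (A ℤ.* A ℤ.+ + 7 ℤ.* (B ℤ.* B)) ≡ ι A ℚ.* ι A ℚ.+ 7ℚ ℚ.* (ι B ℚ.* ι B)
    ι-norm = trans (ι-+ (A ℤ.* A) (+ 7 ℤ.* (B ℤ.* B)))
      (cong₂ ℚ._+_ (ι-* A A) (trans (ι-* (+ 7) (B ℤ.* B)) (cong (7ℚ ℚ.*_) (ι-* B B))))

  0≤p*p : ∀ p → 0ℚ ℚ.≤ p ℚ.* p
  0≤p*p p with ℚ.≤-total 0ℚ p
  ... | inj₁ 0≤p = *-nonNeg 0≤p 0≤p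
  ... | inj₂ p≤0 = subst (0ℚ ℚ.≤_) (solve 1 (λ p → :- p :* :- p := p :* p) refl p)
    (*-nonNeg (ℚ.neg-antimono-≤ p≤0) (ℚ.neg-antimono-≤ p≤0))

  -- error ≤ c (7 - lower²) ≤ 7 c width, with c ≤ 1 + c.
  error-null : ∀ P Q ε → 0ℚ ℚ.< ε → ∃ λ N → ∀ n → N ℕ.≤ n → ℚ.∣ error P Q n ∣ ℚ.< ε
  error-null (a , b) (a′ , b′) ε 0<ε = N , λ n N≤n → begin-strict
    ℚ.∣ c ℚ.* e n ∣                    ≡⟨ ℚ.0≤p⇒∣p∣≡p (*-nonNeg 0≤c (0≤7-lower² n)) ⟩
    c ℚ.* e n                          ≤⟨ ℚ.*-monoˡ-≤-nonNeg c {{ℚ.nonNegative 0≤c}} (7-lower²≤ n) ⟩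
    c ℚ.* (7ℚ ℚ.* width n)             ≤⟨ ℚ.*-monoʳ-≤-nonNeg (7ℚ ℚ.* width n) {{ℚ.nonNegative (ℚ.<⇒≤ (0<7w {n}))}}
                                            (subst (ℚ._≤ d) (ℚ.+-identityʳ c) (ℚ.+-monoʳ-≤ c (ℚ.<⇒≤ (ℚ.positive⁻¹ 1ℚ)))) ⟩
    d ℚ.* (7ℚ ℚ.* width n)             ≡⟨ ℚ.*-assoc d 7ℚ (width n) ⟨
    d ℚ.* 7ℚ ℚ.* width n               ≤⟨ ℚ.*-monoˡ-≤-nonNeg (d ℚ.* 7ℚ) {{ℚ.nonNegative (ℚ.<⇒≤ 0<d7)}} (width-antitone N≤n) ⟩
    d ℚ.* 7ℚ ℚ.* width N               <⟨ ℚ.*-monoʳ-<-pos (d ℚ.* 7ℚ) {{ℚ.positive 0<d7}} (proj₂ Nw) ⟩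
    d ℚ.* 7ℚ ℚ.* (ε ℚ.* r)             ≡⟨ solve 3 (λ D ε r → D :* (ε :* r) := ε :* (D :* r)) refl (d ℚ.* 7ℚ) ε r ⟩
    ε ℚ.* (d ℚ.* 7ℚ ℚ.* r)             ≡⟨ cong (ε ℚ.*_) (ℚ.*-inverseʳ (d ℚ.* 7ℚ) {{d7≢0}}) ⟩
    ε ℚ.* 1ℚ                           ≡⟨ ℚ.*-identityʳ ε ⟩
    ε                                  ∎
    where
    open ℚ.≤-Reasoning
    c d r : ℚ
    c = (ι (b ℤ.- b′) ℚ.* mesh) ℚ.* (ι (b ℤ.- b′) ℚ.* mesh)
    e : ℕ → ℚ
    e n = 7ℚ ℚ.- lower n ℚ.* lower n
    d = c ℚ.+ 1ℚ
    0≤c : 0ℚ ℚ.≤ c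
    0≤c = 0≤p*p (ι (b ℤ.- b′) ℚ.* mesh)
    0<d7 : 0ℚ ℚ.< d ℚ.* 7ℚ
    0<d7 = *-pos (ℚ.+-mono-≤-< 0≤c (ℚ.positive⁻¹ 1ℚ)) (ℚ.positive⁻¹ 7ℚ)
    0<7w : ∀ {n} → 0ℚ ℚ.< 7ℚ ℚ.* width n
    0<7w {n} = *-pos (ℚ.positive⁻¹ 7ℚ) (0<width n)
    d7≢0 : ℚ.NonZero (d ℚ.* 7ℚ)
    d7≢0 = ℚ.>-nonZero 0<d7
    r = (ℚ.1/ (d ℚ.* 7ℚ)) {{d7≢0}}
    Nw : ∃ λ N → width N ℚ.< ε ℚ.* r
    Nw = width<ε (ε ℚ.* r)
      (*-pos 0<ε (ℚ.positive⁻¹ r {{ℚ.1/pos⇒pos (d ℚ.* 7ℚ) {{ℚ.positive 0<d7}}}}))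
    N : ℕ
    N = proj₁ Nw

  norm-square : ∀ m → ι (+ (512 ℕ.* m) ℤ.* + (512 ℕ.* m)) ℚ.* (mesh ℚ.* mesh) ≡ ι (+ m) ℚ.* ι (+ m)
  norm-square m = begin
    ι (+ (512 ℕ.* m) ℤ.* + (512 ℕ.* m)) ℚ.* (mesh ℚ.* mesh)
      ≡⟨ cong (ℚ._* (mesh ℚ.* mesh)) (ι-* (+ (512 ℕ.* m)) (+ (512 ℕ.* m))) ⟩
    ι (+ (512 ℕ.* m)) ℚ.* ι (+ (512 ℕ.* m)) ℚ.* (mesh ℚ.* mesh)
      ≡⟨ cong (λ q → q ℚ.* q ℚ.* (mesh ℚ.* mesh)) (trans (cong ι (ℤ.pos-* 512 m)) (ι-* (+ 512) (+ m))) ⟩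
    (ι (+ 512) ℚ.* ι (+ m)) ℚ.* (ι (+ 512) ℚ.* ι (+ m)) ℚ.* (mesh ℚ.* mesh)
      ≡⟨ solve 3 (λ c m h → (c :* m) :* (c :* m) :* (h :* h) := (c :* h) :* (c :* h) :* (m :* m)) refl (ι (+ 512)) (ι (+ m)) mesh ⟩
    (ι (+ 512) ℚ.* mesh) ℚ.* (ι (+ 512) ℚ.* mesh) ℚ.* (ι (+ m) ℚ.* ι (+ m))
      ≡⟨ ℚ.*-identityˡ _ ⟩
    ι (+ m) ℚ.* ι (+ m) ∎
    where open ≡-Reasoning

  odd⇒Odd : ∀ k → parity k ≡ 1ℙ → Odd (+ k)
  odd⇒Odd (suc zero)    odd = 0ℤ , refl
  odd⇒Odd (suc (suc k)) odd with odd⇒Odd k odd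
  ... | m , k≡2m+1 = 1ℤ ℤ.+ m , trans (ℤ.pos-+ 2 k) (trans (cong (λ j → + 2 ℤ.+ j) k≡2m+1)
    (ℤS.solve 1 (λ m → ℤS.con (+ 2) ℤS.:+ (ℤS.con (+ 2) ℤS.:* m ℤS.:+ ℤS.con 1ℤ) ℤS.:=
                       ℤS.con (+ 2) ℤS.:* (ℤS.con 1ℤ ℤS.:+ m) ℤS.:+ ℤS.con 1ℤ) refl m))

  parity-1+2m : ∀ m → parity (suc (2 ℕ.* m)) ≡ 1ℙ
  parity-1+2m zero    = refl
  parity-1+2m (suc m) = trans (cong (λ j → parity (suc (suc j))) (ℕ.+-suc m (m ℕ.+ 0))) (parity-1+2m m)

  Odd⇒odd : ∀ {k} → Odd k → parity ℤ.∣ k ∣ ≡ 1ℙ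
  Odd⇒odd {k} (+ m , k≡) = trans (cong (λ k → parity ℤ.∣ k ∣)
      (trans k≡ (trans (cong (ℤ._+ + 1) (sym (ℤ.pos-* 2 m))) (sym (ℤ.pos-+ (2 ℕ.* m) 1)))))
    (trans (cong parity (ℕ.+-comm (2 ℕ.* m) 1)) (parity-1+2m m))
  Odd⇒odd {k} (-[1+ m ] , k≡) = trans (cong (λ k → parity ℤ.∣ k ∣) (trans k≡
      (ℤS.solve 1 (λ n → ℤS.con (+ 2) ℤS.:* (ℤS.:- (ℤS.con 1ℤ ℤS.:+ n)) ℤS.:+ ℤS.con 1ℤ ℤS.:=
                         ℤS.:- (ℤS.con 1ℤ ℤS.:+ ℤS.con (+ 2) ℤS.:* n)) refl (+ m))))
    (trans (cong parity (trans (ℤ.∣-i∣≡∣i∣ (1ℤ ℤ.+ + 2 ℤ.* + m))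
        (cong ℤ.∣_∣ (trans (cong (λ j → 1ℤ ℤ.+ j) (sym (ℤ.pos-* 2 m))) (sym (ℤ.pos-+ 1 (2 ℕ.* m)))))))
      (parity-1+2m m))

  ∣k∣²≡k² : ∀ k → + ℤ.∣ k ∣ ℤ.* + ℤ.∣ k ∣ ≡ k ℤ.* k
  ∣k∣²≡k² (+ n)      = refl
  ∣k∣²≡k² -[1+ n ] = refl

  OddlyApart⇒OddDistance : ∀ P Q → OddlyApart P Q → OddDistance (embed P) (embed Q)
  OddlyApart⇒OddDistance P Q (k , odd , norm≡) = + k , odd⇒Odd k odd , 0≤k , λ ε 0<ε →
    let (N , small) = error-null P Q ε 0<ε in N , λ n N≤n →
      subst (λ e → ℚ.∣ e ∣ ℚ.< ε)
        (trans (solve 2 (λ d e → e := d :- (d :- e)) refl (ι (+ k) ℚ.* ι (+ k)) (error P Q n))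
          (cong (λ d → ι (+ k) ℚ.* ι (+ k) ℚ.- d) (sym (distance≡ n))))
        (small n N≤n)
    where
    0≤k : 0ℝ Defs.≤ fromℤ (+ k)
    0≤k ε 0<ε = 0 , λ _ _ → ℚ.+-mono-≤-< (ι-mono-≤ {0ℤ} {+ k} (ℤ.+≤+ ℕ.z≤n)) 0<ε
    distance≡ : ∀ n → seq (square-distance (embed P) (embed Q)) n ≡ ι (+ k) ℚ.* ι (+ k) ℚ.- error P Q n
    distance≡ n = trans (square-distance-embed P Q n) (cong (ℚ._- error P Q n)
      (trans (cong (λ z → ι z ℚ.* (mesh ℚ.* mesh)) norm≡) (norm-square k)))

  -- Both k² and the scaled `norm` are rational constants; their difference is below every ε once
  -- `error` has become small, so it is zero and the mesh can be cancelled.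
  OddDistance⇒OddlyApart : ∀ P Q → OddDistance (embed P) (embed Q) → OddlyApart P Q
  OddDistance⇒OddlyApart P Q (k , odd , _ , k²≈) = ℤ.∣ k ∣ , Odd⇒odd {k} odd ,
    sym (ι-injective (cancel-mesh (cancel-mesh (begin
      ι (K ℤ.* K) ℚ.* mesh ℚ.* mesh       ≡⟨ ℚ.*-assoc (ι (K ℤ.* K)) mesh mesh ⟩
      ι (K ℤ.* K) ℚ.* (mesh ℚ.* mesh)     ≡⟨ norm-square ℤ.∣ k ∣ ⟩
      ι (+ ℤ.∣ k ∣) ℚ.* ι (+ ℤ.∣ k ∣) ≡⟨ ι-* (+ ℤ.∣ k ∣) (+ ℤ.∣ k ∣) ⟨
      ι (+ ℤ.∣ k ∣ ℤ.* + ℤ.∣ k ∣)   ≡⟨ cong ι (∣k∣²≡k² k) ⟩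
      ι (k ℤ.* k)                   ≡⟨ ι-* k k ⟩
      ι k ℚ.* ι k                   ≡⟨ k²≡D ⟩
      D                             ≡⟨ ℚ.*-assoc (ι (norm P Q)) mesh mesh ⟨
      ι (norm P Q) ℚ.* mesh ℚ.* mesh      ∎))))
    where
    open ≡-Reasoning
    K : ℤ
    K = + (512 ℕ.* ℤ.∣ k ∣)
    D : ℚ
    D = ι (norm P Q) ℚ.* (mesh ℚ.* mesh)
    close : ∀ ε → 0ℚ ℚ.< ε → ℚ.∣ ι k ℚ.* ι k ℚ.- D ∣ ℚ.< ε
    close ε 0<ε =
      let (M , near)  = k²≈ (½ ℚ.* ε) 0<ε/2
          (N , small) = error-null P Q (½ ℚ.* ε) 0<ε/2
          n = M ℕ.⊔ N
          e = error P Q n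
      in subst₂ ℚ._<_ (cong ℚ.∣_∣ (solve 3 (λ d x e → (d :- (x :- e)) :- e := d :- x) refl (ι k ℚ.* ι k) D e)) (half ε)
        (ℚ.≤-<-trans (ℚ.∣p-q∣≤∣p∣+∣q∣ (ι k ℚ.* ι k ℚ.- (D ℚ.- e)) e)
          (ℚ.+-mono-< (subst (λ d → ℚ.∣ ι k ℚ.* ι k ℚ.- d ∣ ℚ.< ½ ℚ.* ε) (square-distance-embed P Q n) (near n (ℕ.m≤m⊔n M N)))
                      (small n (ℕ.m≤n⊔m M N))))
      where
      0<ε/2 : 0ℚ ℚ.< ½ ℚ.* ε
      0<ε/2 = *-pos (ℚ.positive⁻¹ ½) 0<ε
    k²≡D : ι k ℚ.* ι k ≡ D
    k²≡D = trans (solve 2 (λ d x → d := (d :- x) :+ x) refl (ι k ℚ.* ι k) D)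
      (trans (cong (ℚ._+ D) (infinitesimal (ι k ℚ.* ι k ℚ.- D) close)) (ℚ.+-identityˡ D))

  p-q≡0⇒p≡q : ∀ p q → p ℚ.- q ≡ 0ℚ → p ≡ q
  p-q≡0⇒p≡q p q eq = trans (solve 2 (λ p q → p := (p :- q) :+ q) refl p q)
    (trans (cong (ℚ._+ q) eq) (ℚ.+-identityˡ q))

  -- The second coordinates carry the factor √7; its approximations are at least 1, so removing it
  -- does not enlarge the difference, which is thus still below every ε.
  embed-injective : ∀ P Q → embed P ≈ₚ embed Q → P ≡ Q
  embed-injective (a , b) (a′ , b′) (x≈ , y≈) = cong₂ _,_ (ι-injective (cancel-mesh (p-q≡0⇒p≡q _ _
      (infinitesimal _ λ ε 0<ε → let (N , near) = x≈ ε 0<ε in near N ℕ.≤-refl))))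
    (ι-injective (cancel-mesh (p-q≡0⇒p≡q _ _
      (infinitesimal _ λ ε 0<ε → let (N , near) = y≈ ε 0<ε in ℚ.≤-<-trans (shrink N) (near N ℕ.≤-refl)))))
    where
    open ℚ.≤-Reasoning
    y = ι b ℚ.* mesh
    y′ = ι b′ ℚ.* mesh
    1≤lower : ∀ n → 1ℚ ℚ.≤ lower n
    1≤lower n = ℚ.≤-trans (ι-mono-≤ {1ℤ} {+ 2} (ℤ.+≤+ (ℕ.s≤s ℕ.z≤n))) (2≤l (brackets n))
    shrink : ∀ n → ℚ.∣ y ℚ.- y′ ∣ ℚ.≤ ℚ.∣ y ℚ.* lower n ℚ.- y′ ℚ.* lower n ∣
    shrink n = begin
      ℚ.∣ y ℚ.- y′ ∣                            ≡⟨ ℚ.*-identityʳ _ ⟨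
      ℚ.∣ y ℚ.- y′ ∣ ℚ.* 1ℚ                     ≤⟨ ℚ.*-monoˡ-≤-nonNeg ℚ.∣ y ℚ.- y′ ∣ {{ℚ.∣-∣-nonNeg (y ℚ.- y′)}} (1≤lower n) ⟩
      ℚ.∣ y ℚ.- y′ ∣ ℚ.* lower n                ≡⟨ cong (ℚ.∣ y ℚ.- y′ ∣ ℚ.*_) (ℚ.0≤p⇒∣p∣≡p (0≤lower n)) ⟨
      ℚ.∣ y ℚ.- y′ ∣ ℚ.* ℚ.∣ lower n ∣          ≡⟨ ℚ.∣p*q∣≡∣p∣*∣q∣ (y ℚ.- y′) (lower n) ⟨
      ℚ.∣ (y ℚ.- y′) ℚ.* lower n ∣              ≡⟨ cong ℚ.∣_∣ (solve 3 (λ y y′ s → (y :- y′) :* s := y :* s :- y′ :* s) refl y y′ (lower n)) ⟩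
      ℚ.∣ y ℚ.* lower n ℚ.- y′ ℚ.* lower n ∣    ∎

  n≤n² : ∀ n → n ℕ.≤ n ℕ.* n
  n≤n² zero    = ℕ.z≤n
  n≤n² (suc n) = ℕ.m≤m*n (suc n) (suc n)

  -- A witness satisfies k ≤ (512 k)² = `norm P Q`, so a bounded search suffices.
  oddlyApart? : ∀ P Q → Dec (OddlyApart P Q)
  oddlyApart? P Q = map′ (λ (k , _ , kP) → k , kP) (λ (k , kP@(_ , norm≡)) → k , bound k norm≡ , kP)
    (ℕ.anyUpTo? (λ k → (parity k ℙ.≟ 1ℙ) ×-dec (norm P Q ℤ.≟ + (512 ℕ.* k) ℤ.* + (512 ℕ.* k)))
      (suc ℤ.∣ norm P Q ∣))
    where
    bound : ∀ k → norm P Q ≡ + (512 ℕ.* k) ℤ.* + (512 ℕ.* k) → k ℕ.< suc ℤ.∣ norm P Q ∣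
    bound k norm≡ = ℕ.s≤s (begin
      k                                     ≤⟨ ℕ.m≤n*m k 512 ⟩
      512 ℕ.* k                             ≤⟨ n≤n² (512 ℕ.* k) ⟩
      (512 ℕ.* k) ℕ.* (512 ℕ.* k)           ≡⟨ cong ℤ.∣_∣ (trans norm≡ (sym (ℤ.pos-* (512 ℕ.* k) (512 ℕ.* k)))) ⟨
      ℤ.∣ norm P Q ∣                        ∎)
      where open ℕ.≤-Reasoning

  OddlyApart-irrefl : ∀ {P} → ¬ OddlyApart P P
  OddlyApart-irrefl {a , b} (suc k , _ , norm≡) = contradiction
    (trans (sym norm≡) (ℤS.solve 2 (λ a b →
      (a ℤS.:- a) ℤS.:* (a ℤS.:- a) ℤS.:+ ℤS.con (+ 7) ℤS.:* ((b ℤS.:- b) ℤS.:* (b ℤS.:- b)) ℤS.:= ℤS.con 0ℤ) refl a b))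
    λ ()

  -- Colourability of finite families of lattice points

  Proper : ∀ {n k} → (Fin n → Lattice) → (Fin n → Fin k) → Set
  Proper pt c = ∀ i j → OddlyApart (pt i) (pt j) → c i ≢ c j

  Colourable : ∀ {n} → ℕ → (Fin n → Lattice) → Set
  Colourable {n} k pt = ∃ λ (c : Fin n → Fin k) → Proper pt c

  -- Without function extensionality a function on `Fin (suc n)` is only pointwise equal to the cons
  -- of its head and tail; `resp` bridges this.
  ∃-function? : ∀ n {k} {P : (Fin n → Fin k) → Set} →
                (∀ {c c′} → c ≗ c′ → P c → P c′) → (∀ c → Dec (P c)) → Dec (∃ P)
  ∃-function? zero    {P = P} resp P? = map′ (λ p → Vector.[] , p) (λ (c , p) → resp (λ ()) p) (P? Vector.[])
  ∃-function? (suc n) {P = P} resp P? = map′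
    (λ (a , c , p) → a Vector.∷ c , p)
    (λ (c , p) → c zero , c ∘ suc , resp (λ { zero → refl ; (suc i) → refl }) p)
    (Fin.any? λ a → ∃-function? n {P = λ c → P (a Vector.∷ c)}
      (λ c≗c′ → resp λ { zero → refl ; (suc i) → c≗c′ i }) (λ c → P? (a Vector.∷ c)))

  colourable? : ∀ {n} k (pt : Fin n → Lattice) → Dec (Colourable k pt)
  colourable? {n} k pt = ∃-function? n
    (λ c≗c′ proper i j apart eq → proper i j apart (trans (c≗c′ i) (trans eq (sym (c≗c′ j)))))
    (λ c → Fin.all? λ i → Fin.all? λ j → oddlyApart? (pt i) (pt j) →-dec ¬? (c i Fin.≟ c j))

  extend-colouring : ∀ {n k} (pt : Fin (suc n) → Lattice) → Colourable k (pt ∘ suc) → Colourable (suc k) pt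
  extend-colouring {n} {k} pt (c , proper) = c′ , proper′
    where
    c′ : Fin (suc n) → Fin (suc k)
    c′ zero    = fromℕ k
    c′ (suc i) = inject₁ (c i)
    proper′ : Proper pt c′
    proper′ zero    zero    apart = contradiction apart (OddlyApart-irrefl {pt zero})
    proper′ zero    (suc j) apart = Fin.fromℕ≢inject₁
    proper′ (suc i) zero    apart = Fin.fromℕ≢inject₁ ∘ sym
    proper′ (suc i) (suc j) apart = proper i j apart ∘ Fin.inject₁-injective

  pointSet : ∀ {n} (pt : Fin n → Lattice) → (∀ {i j} → pt i ≡ pt j → i ≡ j) → FinitePointSet
  pointSet {n} pt injective = record
    { size = n ; point = embed ∘ pt ; distinct = λ i j eq → injective (embed-injective (pt i) (pt j) eq) }

  module _ {n} (pt : Fin n → Lattice) (injective : ∀ {i j} → pt i ≡ pt j → i ≡ j) where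

    private
      G = oddDistanceGraph (pointSet pt injective)

    Colourable⇒Colouring : ∀ {k} → Colourable k pt → Colouring G k
    Colourable⇒Colouring (c , proper) = record
      { colour = c
      ; proper = λ i j (_ , odd) → proper i j (OddDistance⇒OddlyApart (pt i) (pt j) odd) }

    Colouring⇒Colourable : ∀ {k} → Colouring G k → Colourable k pt
    Colouring⇒Colourable col = colour , λ i j apart → proper i j
      ( (λ eq → OddlyApart-irrefl {pt j} (subst (λ P → OddlyApart P (pt j)) (embed-injective (pt i) (pt j) eq) apart))
      , OddlyApart⇒OddDistance (pt i) (pt j) apart )
      where open Colouring col

    exact-chromatic-number : ∀ {k} → Colourable (suc k) pt → ¬ Colourable k pt → HasChromaticNumber G (suc k)
    exact-chromatic-number {k} colourable ¬colourable = Colourable⇒Colouring colourable , λ j col →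
      case suc k ℕ.≤? j of λ where
        (yes k<j) → k<j
        (no  k≮j) → let (c , proper) = Colouring⇒Colourable col
                        j≤k = ℕ.≤-pred (ℕ.≰⇒> k≮j)
                    in contradiction
          ((λ i → inject≤ (c i) j≤k) , λ i l apart eq → proper i l apart (Fin.inject≤-injective j≤k j≤k (c i) (c l) eq))
          ¬colourable

  -- Dropping points one at a time lowers the chromatic number in unit steps.
  chromatic-number-attained : ∀ {n} k (pt : Fin n → Lattice) → (∀ {i j} → pt i ≡ pt j → i ≡ j) →
    ¬ Colourable k pt → ∃ λ V → HasChromaticNumber (oddDistanceGraph V) (suc k)
  chromatic-number-attained {zero}  k pt injective ¬col = contradiction ((λ ()) , λ ()) ¬col
  chromatic-number-attained {suc n} k pt injective ¬col with colourable? k (pt ∘ suc)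
  ... | yes col = pointSet pt injective , exact-chromatic-number pt injective (extend-colouring pt col) ¬col
  ... | no ¬col′ = chromatic-number-attained k (pt ∘ suc) (λ eq → Fin.suc-injective (injective eq)) ¬col′

open OddDistances

open import Data.Integer.Base using (_+_; _*_; _-_; -_; _≤_)
open ℤS using (solve; _:+_; _:*_; _:-_; _:=_; :-_; con)
open import Algebra.Properties.Semiring.Sum ℤ.+-*-semiring
  using (sum; ∑-distrib-+; ∑-permute; *-distribˡ-sum; sum-cong-≗; sum-syntax; sum-replicate-zero)

-- Inequalities between integers

0≤i*i : ∀ i → 0ℤ ≤ i * i
0≤i*i (+ n)      = subst (0ℤ ≤_) (ℤ.pos-* n n) (ℤ.+≤+ ℕ.z≤n)
0≤i*i (ℤ.-[1+ n ]) = ℤ.+≤+ ℕ.z≤n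

-- The pattern of most estimates below: the difference of the sides is written as a sum of evidently
-- nonnegative terms, and the ring solver checks the identity.
by-difference : ∀ {i j e} → 0ℤ ≤ e → j - i ≡ e → i ≤ j
by-difference 0≤e j-i≡e = ℤ.0≤i-j⇒j≤i (subst (0ℤ ≤_) (sym j-i≡e) 0≤e)

difference : ∀ {i j} → i ≤ j → 0ℤ ≤ j - i
difference = ℤ.i≤j⇒0≤j-i

+-nonneg : ∀ {i j} → 0ℤ ≤ i → 0ℤ ≤ j → 0ℤ ≤ i + j
+-nonneg = ℤ.+-mono-≤

*-nonneg : ∀ {i j} → 0ℤ ≤ i → 0ℤ ≤ j → 0ℤ ≤ i * j
*-nonneg {i} {j} 0≤i 0≤j =
  subst (_≤ i * j) (ℤ.*-zeroʳ i) (ℤ.*-monoˡ-≤-nonNeg i {{ℤ.nonNegative 0≤i}} 0≤j)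

-- The binomial coefficients k over 2 and k over 3, with the recursion that `AllPairs` and
-- `AllTriples` follow on lists.
pairs triples : ℕ → ℕ
pairs   zero    = 0
pairs   (suc k) = k ℕ.+ pairs k
triples zero    = 0
triples (suc k) = pairs k ℕ.+ triples k

data AllTriples {A : Set} (R : A → A → A → Set) : List A → Set where
  []  : AllTriples R []
  _∷_ : ∀ {x xs} → AllPairs (R x) xs → AllTriples R xs → AllTriples R (x ∷ xs)

-- Energy estimates for alternating sums along commuting symmetries

module Energy
  {X : Set} (∫ : (X → ℤ) → ℤ)
  (∫-cong : ∀ {f g} → f ≗ g → ∫ f ≡ ∫ g)
  (∫-+ : ∀ f g → ∫ (λ x → f x + g x) ≡ ∫ f + ∫ g)
  (∫-* : ∀ c f → ∫ (λ x → c * f x) ≡ c * ∫ f)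
  (∫-nonneg : ∀ f → (∀ x → 0ℤ ≤ f x) → 0ℤ ≤ ∫ f)
  where

  Fun : Set
  Fun = X → ℤ

  infixl 6 _⊖_
  infixl 7 _·_

  _⊖_ : Fun → Fun → Fun
  (f ⊖ g) x = f x - g x

  _·_ : ℤ → Fun → Fun
  (c · f) x = c * f x

  ⟨_,_⟩ : Fun → Fun → ℤ
  ⟨ f , g ⟩ = ∫ (λ x → f x * g x)

  ∥_∥² : Fun → ℤ
  ∥ f ∥² = ⟨ f , f ⟩

  ⟨⟩-cong : ∀ {f f′ g g′} → f ≗ f′ → g ≗ g′ → ⟨ f , g ⟩ ≡ ⟨ f′ , g′ ⟩
  ⟨⟩-cong f≗f′ g≗g′ = ∫-cong (λ x → cong₂ _*_ (f≗f′ x) (g≗g′ x))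

  ∥∥²-cong : ∀ {f g} → f ≗ g → ∥ f ∥² ≡ ∥ g ∥²
  ∥∥²-cong f≗g = ⟨⟩-cong f≗g f≗g

  ⟨⟩-comm : ∀ f g → ⟨ f , g ⟩ ≡ ⟨ g , f ⟩
  ⟨⟩-comm f g = ∫-cong (λ x → ℤ.*-comm (f x) (g x))

  ∫-⊖ : ∀ f g → ∫ (f ⊖ g) ≡ ∫ f - ∫ g
  ∫-⊖ f g = begin
    ∫ (f ⊖ g)                     ≡⟨ ∫-cong (λ x → cong (λ y → f x + y) (ℤ.-1*i≡-i (g x))) ⟨
    ∫ (λ x → f x + -1ℤ * g x)     ≡⟨ ∫-+ f (-1ℤ · g) ⟩
    ∫ f + ∫ (-1ℤ · g)             ≡⟨ cong (λ y → ∫ f + y) (trans (∫-* -1ℤ g) (ℤ.-1*i≡-i (∫ g))) ⟩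
    ∫ f - ∫ g                     ∎
    where open ≡-Reasoning

  ⟨⟩-⊖ˡ : ∀ f g h → ⟨ f ⊖ g , h ⟩ ≡ ⟨ f , h ⟩ - ⟨ g , h ⟩
  ⟨⟩-⊖ˡ f g h = trans
    (∫-cong (λ x → solve 3 (λ a b c → (a :- b) :* c := a :* c :- b :* c) refl (f x) (g x) (h x)))
    (∫-⊖ (λ x → f x * h x) (λ x → g x * h x))

  ⟨⟩-⊖ʳ : ∀ f g h → ⟨ f , g ⊖ h ⟩ ≡ ⟨ f , g ⟩ - ⟨ f , h ⟩
  ⟨⟩-⊖ʳ f g h = trans (⟨⟩-comm f (g ⊖ h))
    (trans (⟨⟩-⊖ˡ g h f) (cong₂ _-_ (⟨⟩-comm g f) (⟨⟩-comm h f)))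

  ⟨⟩-+ˡ : ∀ f g h → ⟨ (λ x → f x + g x) , h ⟩ ≡ ⟨ f , h ⟩ + ⟨ g , h ⟩
  ⟨⟩-+ˡ f g h = trans
    (∫-cong (λ x → ℤ.*-distribʳ-+ (h x) (f x) (g x)))
    (∫-+ (λ x → f x * h x) (λ x → g x * h x))

  ⟨⟩-+ʳ : ∀ f g h → ⟨ f , (λ x → g x + h x) ⟩ ≡ ⟨ f , g ⟩ + ⟨ f , h ⟩
  ⟨⟩-+ʳ f g h = trans (⟨⟩-comm f _)
    (trans (⟨⟩-+ˡ g h f) (cong₂ _+_ (⟨⟩-comm g f) (⟨⟩-comm h f)))

  ⟨⟩-·ˡ : ∀ c f g → ⟨ c · f , g ⟩ ≡ c * ⟨ f , g ⟩
  ⟨⟩-·ˡ c f g = trans (∫-cong (λ x → ℤ.*-assoc c (f x) (g x))) (∫-* c _)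

  ⟨⟩-·ʳ : ∀ c f g → ⟨ f , c · g ⟩ ≡ c * ⟨ f , g ⟩
  ⟨⟩-·ʳ c f g = trans (⟨⟩-comm f (c · g)) (trans (⟨⟩-·ˡ c g f) (cong (c *_) (⟨⟩-comm g f)))

  ∥∥²-nonneg : ∀ f → 0ℤ ≤ ∥ f ∥²
  ∥∥²-nonneg f = ∫-nonneg _ (λ x → 0≤i*i (f x))

  ∥⊖∥² : ∀ f g → ∥ f ⊖ g ∥² ≡ ∥ f ∥² - + 2 * ⟨ f , g ⟩ + ∥ g ∥²
  ∥⊖∥² f g = begin
    ⟨ f ⊖ g , f ⊖ g ⟩                       ≡⟨ ⟨⟩-⊖ˡ f g (f ⊖ g) ⟩
    ⟨ f , f ⊖ g ⟩ - ⟨ g , f ⊖ g ⟩           ≡⟨ cong₂ _-_ (⟨⟩-⊖ʳ f f g) (trans (⟨⟩-⊖ʳ g f g) (cong (_- ∥ g ∥²) (⟨⟩-comm g f))) ⟩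
    ∥ f ∥² - ⟨ f , g ⟩ - (⟨ f , g ⟩ - ∥ g ∥²) ≡⟨ solve 3 (λ a b c → a :- b :- (b :- c) := a :- con (+ 2) :* b :+ c) refl ∥ f ∥² ⟨ f , g ⟩ ∥ g ∥² ⟩
    ∥ f ∥² - + 2 * ⟨ f , g ⟩ + ∥ g ∥²       ∎
    where open ≡-Reasoning

  ∥+∥² : ∀ f g → ∥ (λ x → f x + g x) ∥² ≡ ∥ f ∥² + + 2 * ⟨ f , g ⟩ + ∥ g ∥²
  ∥+∥² f g = begin
    ∥ (λ x → f x + g x) ∥²                    ≡⟨ ⟨⟩-+ˡ f g _ ⟩
    ⟨ f , (λ x → f x + g x) ⟩ + ⟨ g , (λ x → f x + g x) ⟩
      ≡⟨ cong₂ _+_ (⟨⟩-+ʳ f f g) (trans (⟨⟩-+ʳ g f g) (cong (_+ ∥ g ∥²) (⟨⟩-comm g f))) ⟩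
    ∥ f ∥² + ⟨ f , g ⟩ + (⟨ f , g ⟩ + ∥ g ∥²) ≡⟨ solve 3 (λ a b c → a :+ b :+ (b :+ c) := a :+ con (+ 2) :* b :+ c) refl ∥ f ∥² ⟨ f , g ⟩ ∥ g ∥² ⟩
    ∥ f ∥² + + 2 * ⟨ f , g ⟩ + ∥ g ∥²         ∎
    where open ≡-Reasoning

  ∥·∥² : ∀ c f → ∥ c · f ∥² ≡ c * c * ∥ f ∥²
  ∥·∥² c f = trans (⟨⟩-·ˡ c f (c · f)) (trans (cong (c *_) (⟨⟩-·ʳ c f f)) (sym (ℤ.*-assoc c c ∥ f ∥²)))

  -- 0 ≤ ∥ c f - g ∥², expanded.
  completed-square : ∀ c f g → 0ℤ ≤ c * c * ∥ f ∥² - + 2 * (c * ⟨ f , g ⟩) + ∥ g ∥²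
  completed-square c f g = subst (0ℤ ≤_)
    (trans (∥⊖∥² (c · f) g)
      (cong₂ (λ a b → a - + 2 * b + ∥ g ∥²) (∥·∥² c f) (⟨⟩-·ˡ c f g)))
    (∥∥²-nonneg (c · f ⊖ g))

  -- Says that the norm of f is at most c √F, squared in order to stay in ℤ.
  record Bounded (F : ℤ) (c : ℕ) (f : Fun) : Set where
    constructor bounded
    field
      energy≤ : ∥ f ∥² ≤ + c * + c * F

  open Bounded

  Bounded-≤ : ∀ {F c d f} → 0ℤ ≤ F → c ℕ.≤ d → Bounded F c f → Bounded F d f
  Bounded-≤ {F} {c} {d} 0≤F c≤d (bounded bf) = bounded (ℤ.≤-trans bf
    (ℤ.*-monoʳ-≤-nonNeg F {{ℤ.nonNegative 0≤F}}
      (subst₂ _≤_ (ℤ.pos-* c c) (ℤ.pos-* d d) (ℤ.+≤+ (ℕ.*-mono-≤ c≤d c≤d)))))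

  Bounded-cong : ∀ {F c f g} → f ≗ g → Bounded F c f → Bounded F c g
  Bounded-cong {F} {c} f≗g (bounded bf) = bounded (subst (_≤ + c * + c * F) (∥∥²-cong f≗g) bf)

  -- The triangle inequality for norms. The cross term is estimated after multiplication by 2 c d,
  -- which is cancelled at the end; this is where c and d must be nonzero.
  Bounded-+ : ∀ {F c d f g} .{{_ : NonZero c}} .{{_ : NonZero d}} →
              Bounded F c f → Bounded F d g → Bounded F (c ℕ.+ d) (λ x → f x + g x)
  Bounded-+ {F} {c@(suc _)} {d@(suc _)} {f} {g} (bounded bf) (bounded bg) = bounded
    (subst (λ e → ∥ (λ x → f x + g x) ∥² ≤ e * e * F) (sym (ℤ.pos-+ c d))
      (by-difference (+-nonneg (+-nonneg (difference bf) (difference bg))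
                               (*-nonneg {+ 2} (ℤ.+≤+ ℕ.z≤n) (difference ⟨f,g⟩≤)))
        (trans (cong (λ y → (+ c + + d) * (+ c + + d) * F - y) (∥+∥² f g))
          (solve 6 (λ c d F a b e →
            (c :+ d) :* (c :+ d) :* F :- (a :+ con (+ 2) :* b :+ e) :=
            (c :* c :* F :- a) :+ (d :* d :* F :- e) :+ con (+ 2) :* (c :* d :* F :- b))
            refl (+ c) (+ d) F ∥ f ∥² ⟨ f , g ⟩ ∥ g ∥²))))
    where
    -- 2 c d ⟨ f , g ⟩ ≤ ∥ d f ∥² + ∥ c g ∥² ≤ 2 c² d² F
    scaled : (+ 2 * (+ c * + d)) * ⟨ f , g ⟩ ≤ (+ 2 * (+ c * + d)) * (+ c * + d * F)
    scaled = by-difference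
      (+-nonneg
        (subst (0ℤ ≤_) (∥⊖∥² (+ d · f) (+ c · g)) (∥∥²-nonneg (+ d · f ⊖ + c · g)))
        (+-nonneg (*-nonneg (0≤i*i (+ d)) (difference bf)) (*-nonneg (0≤i*i (+ c)) (difference bg))))
      (trans
        (solve 6 (λ c d F a b e →
          (con (+ 2) :* (c :* d)) :* (c :* d :* F) :- (con (+ 2) :* (c :* d)) :* b :=
          ((d :* d :* a) :- con (+ 2) :* (d :* (c :* b)) :+ (c :* c :* e)) :+
          ((d :* d) :* (c :* c :* F :- a) :+ (c :* c) :* (d :* d :* F :- e)))
          refl (+ c) (+ d) F ∥ f ∥² ⟨ f , g ⟩ ∥ g ∥²)
        (cong (_+ ((+ d * + d) * (+ c * + c * F - ∥ f ∥²) + (+ c * + c) * (+ d * + d * F - ∥ g ∥²)))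
          (sym (cong₂ _+_
            (cong₂ (λ a b → a - + 2 * b) (∥·∥² (+ d) f)
              (trans (⟨⟩-·ˡ (+ d) f (+ c · g)) (cong (+ d *_) (⟨⟩-·ʳ (+ c) f g))))
            (∥·∥² (+ c) g)))))
    ⟨f,g⟩≤ : ⟨ f , g ⟩ ≤ + c * + d * F
    ⟨f,g⟩≤ = ℤ.*-cancelˡ-≤-pos _ _ (+ 2 * (+ c * + d)) scaled

  -- Invertible measure preserving maps

  record Symmetry : Set where
    field
      to from : X → X
      to-from : ∀ x → to (from x) ≡ x
      from-to : ∀ x → from (to x) ≡ x
      ∫-to    : ∀ f → ∫ (f ∘ to) ≡ ∫ f

  open Symmetry

  inverse : Symmetry → Symmetry
  inverse σ = record
    { to = from σ ; from = to σ ; to-from = from-to σ ; from-to = to-from σ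
    ; ∫-to = λ f → trans (sym (∫-to σ (f ∘ from σ))) (∫-cong (λ x → cong f (from-to σ x))) }

  infix 4 _⇄_

  _⇄_ : Symmetry → Symmetry → Set
  σ ⇄ τ = ∀ x → to σ (to τ x) ≡ to τ (to σ x)

  ⇄-sym : ∀ {σ τ} → σ ⇄ τ → τ ⇄ σ
  ⇄-sym σ⇄τ x = sym (σ⇄τ x)

  ⇄-inverse : ∀ {σ τ} → σ ⇄ τ → σ ⇄ inverse τ
  ⇄-inverse {σ} {τ} σ⇄τ x = begin
    to σ (from τ x)                        ≡⟨ from-to τ _ ⟨
    from τ (to τ (to σ (from τ x)))        ≡⟨ cong (from τ) (σ⇄τ (from τ x)) ⟨
    from τ (to σ (to τ (from τ x)))        ≡⟨ cong (from τ ∘ to σ) (to-from τ x) ⟩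
    from τ (to σ x)                        ∎
    where open ≡-Reasoning

  ⇄-refl : ∀ {σ} → σ ⇄ σ
  ⇄-refl x = refl

  adjoint-to : ∀ σ f g → ⟨ f ∘ to σ , g ⟩ ≡ ⟨ f , g ∘ from σ ⟩
  adjoint-to σ f g = trans
    (⟨⟩-cong {f ∘ to σ} (λ _ → refl) (λ x → cong g (sym (from-to σ x))))
    (∫-to σ (λ x → f x * g (from σ x)))

  -- The alternating sum f - f ∘ σ + f ∘ σ² - ⋯ of n terms.
  alt : ℕ → Symmetry → Fun → Fun
  alt zero    σ f x = 0ℤ
  alt (suc n) σ f x = f x - alt n σ f (to σ x)

  alt-cong : ∀ n σ {f g} → f ≗ g → alt n σ f ≗ alt n σ g
  alt-cong zero    σ f≗g x = refl
  alt-cong (suc n) σ f≗g x = cong₂ _-_ (f≗g x) (alt-cong n σ f≗g (to σ x))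

  alt-0 : ∀ n σ x → alt n σ (λ _ → 0ℤ) x ≡ 0ℤ
  alt-0 zero    σ x = refl
  alt-0 (suc n) σ x = cong (λ y → 0ℤ - y) (alt-0 n σ (to σ x))

  alt-⊖ : ∀ n σ f g → alt n σ (f ⊖ g) ≗ alt n σ f ⊖ alt n σ g
  alt-⊖ zero    σ f g x = refl
  alt-⊖ (suc n) σ f g x = trans (cong (λ y → f x - g x - y) (alt-⊖ n σ f g (to σ x)))
    (solve 4 (λ a b c d → a :- b :- (c :- d) := a :- c :- (b :- d)) refl
      (f x) (g x) (alt n σ f (to σ x)) (alt n σ g (to σ x)))

  alt-∘ : ∀ n σ τ f → σ ⇄ τ → ∀ x → alt n σ (f ∘ to τ) x ≡ alt n σ f (to τ x)
  alt-∘ zero    σ τ f σ⇄τ x = refl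
  alt-∘ (suc n) σ τ f σ⇄τ x = cong (λ y → f (to τ x) - y)
    (trans (alt-∘ n σ τ f σ⇄τ (to σ x)) (cong (alt n σ f) (sym (σ⇄τ x))))

  alt-comm : ∀ m n σ τ f → σ ⇄ τ → alt m σ (alt n τ f) ≗ alt n τ (alt m σ f)
  alt-comm m zero    σ τ f σ⇄τ x = alt-0 m σ x
  alt-comm m (suc n) σ τ f σ⇄τ x = trans (alt-⊖ m σ f (alt n τ f ∘ to τ) x)
    (cong (λ y → alt m σ f x - y)
      (trans (alt-∘ m σ τ (alt n τ f) σ⇄τ x) (alt-comm m n σ τ f σ⇄τ (to τ x))))

  -- A measure preserving shift is unitary, so its adjoint is its inverse; signs are real and pass
  -- through.
  alt-adjoint : ∀ n σ f g → ⟨ alt n σ f , g ⟩ ≡ ⟨ f , alt n (inverse σ) g ⟩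
  alt-adjoint zero    σ f g = sym (trans (⟨⟩-comm f _) refl)
  alt-adjoint (suc n) σ f g = begin
    ⟨ f ⊖ alt n σ f ∘ to σ , g ⟩                          ≡⟨ ⟨⟩-⊖ˡ f _ g ⟩
    ⟨ f , g ⟩ - ⟨ alt n σ f ∘ to σ , g ⟩                  ≡⟨ cong (λ y → ⟨ f , g ⟩ - y) (adjoint-to σ (alt n σ f) g) ⟩
    ⟨ f , g ⟩ - ⟨ alt n σ f , g ∘ from σ ⟩                ≡⟨ cong (λ y → ⟨ f , g ⟩ - y) (alt-adjoint n σ f (g ∘ from σ)) ⟩
    ⟨ f , g ⟩ - ⟨ f , alt n (inverse σ) (g ∘ from σ) ⟩
      ≡⟨ cong (λ y → ⟨ f , g ⟩ - y) (⟨⟩-cong {f} (λ _ → refl) (alt-∘ n (inverse σ) (inverse σ) g (⇄-refl {inverse σ}))) ⟩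
    ⟨ f , g ⟩ - ⟨ f , alt n (inverse σ) g ∘ from σ ⟩      ≡⟨ ⟨⟩-⊖ʳ f g _ ⟨
    ⟨ f , g ⊖ alt n (inverse σ) g ∘ from σ ⟩              ∎
    where open ≡-Reasoning

  -- The power (- σ)ᵖ of the signed shift.
  twist : ℕ → Symmetry → Fun → Fun
  twist zero    σ f x = f x
  twist (suc p) σ f x = - twist p σ f (to σ x)

  twist-⊖ : ∀ p σ f g → twist p σ (f ⊖ g) ≗ twist p σ f ⊖ twist p σ g
  twist-⊖ zero    σ f g x = refl
  twist-⊖ (suc p) σ f g x = trans (cong -_ (twist-⊖ p σ f g (to σ x)))
    (solve 2 (λ a b → :- (a :- b) := :- a :- :- b) refl (twist p σ f (to σ x)) (twist p σ g (to σ x)))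

  ∥twist∥² : ∀ p σ f → ∥ twist p σ f ∥² ≡ ∥ f ∥²
  ∥twist∥² zero    σ f = refl
  ∥twist∥² (suc p) σ f = begin
    ∥ twist (suc p) σ f ∥²       ≡⟨ ∫-cong (λ x → solve 1 (λ a → :- a :* :- a := a :* a) refl (twist p σ f (to σ x))) ⟩
    ∥ twist p σ f ∘ to σ ∥²      ≡⟨ ∫-to σ (λ x → twist p σ f x * twist p σ f x) ⟩
    ∥ twist p σ f ∥²             ≡⟨ ∥twist∥² p σ f ⟩
    ∥ f ∥²                       ∎
    where open ≡-Reasoning

  alt-+ : ∀ m n σ f x → alt (m ℕ.+ n) σ f x ≡ alt m σ f x + twist m σ (alt n σ f) x
  alt-+ zero    n σ f x = sym (ℤ.+-identityˡ _)
  alt-+ (suc m) n σ f x = trans (cong (λ y → f x - y) (alt-+ m n σ f (to σ x)))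
    (solve 3 (λ a b c → a :- (b :+ c) := a :- b :+ :- c) refl
      (f x) (alt m σ f (to σ x)) (twist m σ (alt n σ f) (to σ x)))

  -- (1 - Vᵖ)(1 + V + ⋯ + Vⁿ⁻¹) = (1 - Vⁿ)(1 + V + ⋯ + Vᵖ⁻¹) for V = - σ.
  alt-telescopes : ∀ n p σ f → alt n σ f ⊖ twist p σ (alt n σ f) ≗ alt p σ f ⊖ twist n σ (alt p σ f)
  alt-telescopes n p σ f x = begin
    a - b                 ≡⟨ solve 3 (λ a b c → a :- b := c :+ a :- (c :+ b)) refl a b c ⟩
    c + a - (c + b)       ≡⟨ cong (λ y → c + a - y) (alt-+ p n σ f x) ⟨
    c + a - alt (p ℕ.+ n) σ f x ≡⟨ cong (λ m → c + a - alt m σ f x) (ℕ.+-comm p n) ⟩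
    c + a - alt (n ℕ.+ p) σ f x ≡⟨ cong (λ y → c + a - y) (alt-+ n p σ f x) ⟩
    c + a - (a + d)       ≡⟨ solve 3 (λ a c d → c :+ a :- (a :+ d) := c :- d) refl a c d ⟩
    c - d                 ∎
    where
    open ≡-Reasoning
    a = alt n σ f x
    b = twist p σ (alt n σ f) x
    c = alt p σ f x
    d = twist n σ (alt p σ f) x

  Bounded-twist : ∀ {F c f} p σ → Bounded F c f → Bounded F c (twist p σ f)
  Bounded-twist {F} {c} {f} p σ (bounded bf) =
    bounded (subst (_≤ + c * + c * F) (sym (∥twist∥² p σ f)) bf)

  Bounded-neg : ∀ {F c f} → Bounded F c f → Bounded F c (λ x → - f x)
  Bounded-neg {F} {c} {f} (bounded bf) = bounded (subst (_≤ + c * + c * F)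
    (∫-cong (λ x → solve 1 (λ a → a :* a := :- a :* :- a) refl (f x))) bf)

  Bounded-⊖ : ∀ {F c d f g} .{{_ : NonZero c}} .{{_ : NonZero d}} →
              Bounded F c f → Bounded F d g → Bounded F (c ℕ.+ d) (f ⊖ g)
  Bounded-⊖ bf bg = Bounded-+ bf (Bounded-neg bg)

  Bounded-0 : ∀ {F} c → 0ℤ ≤ F → Bounded F c (λ _ → 0ℤ)
  Bounded-0 {F} c 0≤F = bounded (subst (_≤ + c * + c * F) (sym (∫-* 0ℤ (λ _ → 0ℤ)))
    (*-nonneg (0≤i*i (+ c)) 0≤F))

  -- The n terms are signed isometric images of f. The factor is `suc n` so that it is nonzero even
  -- for the empty sum, as `Bounded-⊖` demands.
  Bounded-alt : ∀ {F c f} .{{_ : NonZero c}} n σ → 0ℤ ≤ F →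
                Bounded F c f → Bounded F (suc n ℕ.* c) (alt n σ f)
  Bounded-alt {c = c} zero    σ 0≤F bf = Bounded-0 (suc zero ℕ.* c) 0≤F
  Bounded-alt {F} {c} {f} (suc n) σ 0≤F bf =
    Bounded-⊖ bf (bounded
      (subst (_≤ + (suc n ℕ.* c) * + (suc n ℕ.* c) * F)
        (sym (∫-to σ (λ x → alt n σ f x * alt n σ f x)))
        (energy≤ (Bounded-alt n σ 0≤F bf))))
    where
    instance
      suc-n*c≢0 : NonZero (suc n ℕ.* c)
      suc-n*c≢0 = ℕ.m*n≢0 (suc n) c

  double : ℕ → ℕ
  double n = n ℕ.+ n

  Bounded-halve : ∀ {F c h} → Bounded F (double c) (λ x → h x + h x) → Bounded F c h
  Bounded-halve {F} {c} {h} (bounded b2h) = bounded (ℤ.*-cancelˡ-≤-pos _ _ (+ 4) (subst₂ _≤_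
    (trans (∥+∥² h h) (solve 1 (λ a → a :+ con (+ 2) :* a :+ a := con (+ 4) :* a) refl ∥ h ∥²))
    (trans (cong (λ d → d * d * F) (ℤ.pos-+ c c))
      (solve 2 (λ c F → (c :+ c) :* (c :+ c) :* F := con (+ 4) :* (c :* c :* F)) refl (+ c) F))
    b2h))

  -- Some product of powers of the - σᵢ equals minus another one.
  record OddRelation (C : ℕ) (σ₁ σ₂ σ₃ : Symmetry) : Set where
    field
      p₁ p₂ p₃ q₁ q₂ q₃ : ℕ
      opposite : ∀ h x → twist p₁ σ₁ (twist p₂ σ₂ (twist p₃ σ₃ h)) x ≡
                       - twist q₁ σ₁ (twist q₂ σ₂ (twist q₃ σ₃ h)) x
      weight   : (suc p₁ ℕ.+ suc p₂ ℕ.+ suc p₃) ℕ.+ (suc q₁ ℕ.+ suc q₂ ℕ.+ suc q₃) ℕ.≤ C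

  module _ (n : ℕ) where

    -- Bounds the ℓ¹ norm n of the coefficients of alt n, and is never zero.
    κ : ℕ
    κ = suc n

    -- Each - σᵢ nearly fixes h = alt n σ₁ (alt n σ₂ (alt n σ₃ f)), so the
    -- relation says that h nearly equals - h.
    module _ {σ₁ σ₂ σ₃ : Symmetry} (c₁₂ : σ₁ ⇄ σ₂) (c₁₃ : σ₁ ⇄ σ₃) (c₂₃ : σ₂ ⇄ σ₃) (f : Fun) where

      private
        F : ℤ
        F = ∥ f ∥²

        0≤F : 0ℤ ≤ F
        0≤F = ∥∥²-nonneg f

        h : Fun
        h = alt n σ₁ (alt n σ₂ (alt n σ₃ f))

        d : ℕ
        d = κ ℕ.* (κ ℕ.* 1)

        b₁ : Bounded F 1 f
        b₁ = bounded (ℤ.≤-reflexive (sym (ℤ.*-identityˡ F)))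

        b₃ : ∀ σ τ → Bounded F d (alt n σ (alt n τ f))
        b₃ σ τ = Bounded-alt n σ 0≤F (Bounded-alt n τ 0≤F b₁)

        -- After telescoping, only p terms survive at each end of the sum of n terms. One factor `κ`
        -- of the trivial bound `κ`³ for `h` is thereby traded for 2 (p + 1).
        defect : ∀ p σ g → Bounded F d g → h ≗ alt n σ g →
                 Bounded F (double (suc p ℕ.* d)) (h ⊖ twist p σ h)
        defect p σ g bg h≗ = Bounded-cong
          (λ x → sym (trans (cong₂ _-_ (h≗ x) (twist-cong p x)) (alt-telescopes n p σ g x)))
          (Bounded-⊖
            (Bounded-alt p σ 0≤F bg)
            (Bounded-twist n σ (Bounded-alt p σ 0≤F bg)))
          where
          twist-cong : ∀ p → twist p σ h ≗ twist p σ (alt n σ g)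
          twist-cong zero    x = h≗ x
          twist-cong (suc p) x = cong -_ (twist-cong p (to σ x))

        defect₁ : ∀ p → Bounded F (double (suc p ℕ.* d)) (h ⊖ twist p σ₁ h)
        defect₁ p = defect p σ₁ _ (b₃ σ₂ σ₃) (λ _ → refl)

        defect₂ : ∀ p → Bounded F (double (suc p ℕ.* d)) (h ⊖ twist p σ₂ h)
        defect₂ p = defect p σ₂ _ (b₃ σ₁ σ₃) (alt-comm n n σ₁ σ₂ (alt n σ₃ f) c₁₂)

        defect₃ : ∀ p → Bounded F (double (suc p ℕ.* d)) (h ⊖ twist p σ₃ h)
        defect₃ p = defect p σ₃ _ (b₃ σ₁ σ₂) (λ x → trans
          (alt-cong n σ₁ (alt-comm n n σ₂ σ₃ f c₂₃) x)
          (alt-comm n n σ₁ σ₃ (alt n σ₂ f) c₁₃ x))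

        bound : ℕ → ℕ → ℕ → ℕ
        bound p₁ p₂ p₃ = double (suc p₁ ℕ.* d) ℕ.+ double (suc p₂ ℕ.* d) ℕ.+ double (suc p₃ ℕ.* d)

        -- With Vᵢ the three twists, 1 - V₁V₂V₃ = (1 - V₁) + V₁(1 - V₂) + V₁V₂(1 - V₃), and twisting
        -- preserves norms.
        total-defect : ∀ p₁ p₂ p₃ → Bounded F (bound p₁ p₂ p₃)
          (h ⊖ twist p₁ σ₁ (twist p₂ σ₂ (twist p₃ σ₃ h)))
        total-defect p₁ p₂ p₃ = Bounded-cong sums
          (Bounded-+
            (Bounded-+
              (defect₁ p₁) (Bounded-twist p₁ σ₁ (defect₂ p₂)))
            (Bounded-twist p₁ σ₁ (Bounded-twist p₂ σ₂ (defect₃ p₃))))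
          where
          e₁ e₂ e₃ : Fun
          e₁ = h ⊖ twist p₁ σ₁ h
          e₂ = twist p₁ σ₁ (h ⊖ twist p₂ σ₂ h)
          e₃ = twist p₁ σ₁ (twist p₂ σ₂ (h ⊖ twist p₃ σ₃ h))
          twist-cong : ∀ p {g g′} → g ≗ g′ → twist p σ₁ g ≗ twist p σ₁ g′
          twist-cong zero    g≗ x = g≗ x
          twist-cong (suc p) g≗ x = cong -_ (twist-cong p g≗ (to σ₁ x))
          sums : (λ x → e₁ x + e₂ x + e₃ x) ≗ h ⊖ twist p₁ σ₁ (twist p₂ σ₂ (twist p₃ σ₃ h))
          sums x = trans
            (cong₂ (λ a b → e₁ x + a + b) (twist-⊖ p₁ σ₁ h (twist p₂ σ₂ h) x)
              (trans (twist-cong p₁ (twist-⊖ p₂ σ₂ h (twist p₃ σ₃ h)) x)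
                     (twist-⊖ p₁ σ₁ (twist p₂ σ₂ h) (twist p₂ σ₂ (twist p₃ σ₃ h)) x)))
            (solve 4 (λ a b c d → (a :- b) :+ (b :- c) :+ (c :- d) := a :- d) refl
              (h x) (twist p₁ σ₁ h x) (twist p₁ σ₁ (twist p₂ σ₂ h) x)
              (twist p₁ σ₁ (twist p₂ σ₂ (twist p₃ σ₃ h)) x))

      -- In the sum of the defects of the two sides of the relation the twisted terms cancel and 2
      -- `h` remains. The bound C `κ`² beats the trivial `κ`³ as soon as n is large compared with C.
      OddRelation⇒Bounded : ∀ {C} → OddRelation C σ₁ σ₂ σ₃ → Bounded F (C ℕ.* d) h
      OddRelation⇒Bounded {C} r = Bounded-≤ 0≤F (ℕ.*-monoˡ-≤ d weight)
        (Bounded-halve (subst (λ c → Bounded F c (λ x → h x + h x)) bounds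
          (Bounded-cong sums
            (Bounded-+ (total-defect p₁ p₂ p₃) (total-defect q₁ q₂ q₃)))))
        where
        open OddRelation r
        m : ℕ
        m = (suc p₁ ℕ.+ suc p₂ ℕ.+ suc p₃) ℕ.+ (suc q₁ ℕ.+ suc q₂ ℕ.+ suc q₃)
        sums : ∀ x → (h x - twist p₁ σ₁ (twist p₂ σ₂ (twist p₃ σ₃ h)) x) +
                     (h x - twist q₁ σ₁ (twist q₂ σ₂ (twist q₃ σ₃ h)) x) ≡ h x + h x
        sums x = trans
          (cong (λ a → (h x - a) + (h x - twist q₁ σ₁ (twist q₂ σ₂ (twist q₃ σ₃ h)) x)) (opposite h x))
          (solve 2 (λ a b → (a :- :- b) :+ (a :- b) := a :+ a) refl
            (h x) (twist q₁ σ₁ (twist q₂ σ₂ (twist q₃ σ₃ h)) x))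
        bounds : bound p₁ p₂ p₃ ℕ.+ bound q₁ q₂ q₃ ≡ double (m ℕ.* d)
        bounds = ℕS.solve 7 (λ p₁ p₂ p₃ q₁ q₂ q₃ d →
          let s a = ℕS.con 1 ℕS.:+ a
              t a = s a ℕS.:* d ℕS.:+ s a ℕS.:* d
              k = (s p₁ ℕS.:+ s p₂ ℕS.:+ s p₃) ℕS.:+ (s q₁ ℕS.:+ s q₂ ℕS.:+ s q₃)
          in (t p₁ ℕS.:+ t p₂ ℕS.:+ t p₃) ℕS.:+ (t q₁ ℕS.:+ t q₂ ℕS.:+ t q₃) ℕS.:=
             (k ℕS.:* d ℕS.:+ k ℕS.:* d)) refl p₁ p₂ p₃ q₁ q₂ q₃ d

    a a* : Symmetry → Fun → Fun
    a  σ = alt n σ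
    a* σ = alt n (inverse σ)

    -- For commuting symmetries, the quadratic forms of the elementary symmetric polynomials of
    -- degree 1, 2, 3 in the operators `a* σ ∘ a σ`.
    energy energy₂ energy₃ : List Symmetry → Fun → ℤ
    energy  []      f = 0ℤ
    energy  (σ ∷ L) f = ∥ a σ f ∥² + energy L f
    energy₂ []      f = 0ℤ
    energy₂ (σ ∷ L) f = energy L (a σ f) + energy₂ L f
    energy₃ []      f = 0ℤ
    energy₃ (σ ∷ L) f = energy₂ L (a σ f) + energy₃ L f

    frame : List Symmetry → Fun → Fun
    frame []      f x = 0ℤ
    frame (σ ∷ L) f x = a* σ (a σ f) x + frame L f x

    ∥alt∥²≤ : ∀ σ f → ∥ alt n σ f ∥² ≤ + κ * + κ * ∥ f ∥²
    ∥alt∥²≤ σ f = subst (λ c → ∥ alt n σ f ∥² ≤ + c * + c * ∥ f ∥²) (ℕ.*-identityʳ κ)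
      (energy≤ (Bounded-alt {c = 1} n σ (∥∥²-nonneg f)
        (bounded (ℤ.≤-reflexive (sym (ℤ.*-identityˡ ∥ f ∥²))))))

    ⟨f,a*af⟩ : ∀ σ f → ⟨ f , a* σ (a σ f) ⟩ ≡ ∥ a σ f ∥²
    ⟨f,a*af⟩ σ f = sym (alt-adjoint n σ f (a σ f))

    -- `a τ` commutes with `a σ` and also with `a* σ`, so the cross terms of the frame operator are
    -- themselves squared norms.
    ⟨a*af,a*af⟩ : ∀ {σ τ} f → σ ⇄ τ → ⟨ a* σ (a σ f) , a* τ (a τ f) ⟩ ≡ ∥ a τ (a σ f) ∥²
    ⟨a*af,a*af⟩ {σ} {τ} f σ⇄τ = begin
      ⟨ a* σ (a σ f) , a* τ (a τ f) ⟩ ≡⟨ alt-adjoint n τ (a* σ (a σ f)) (a τ f) ⟨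
      ⟨ a τ (a* σ (a σ f)) , a τ f ⟩
        ≡⟨ ⟨⟩-cong {g = a τ f} (alt-comm n n τ (inverse σ) (a σ f) (⇄-inverse {τ} {σ} (⇄-sym {σ} {τ} σ⇄τ))) (λ _ → refl) ⟩
      ⟨ a* σ (a τ (a σ f)) , a τ f ⟩  ≡⟨ ⟨⟩-comm _ (a τ f) ⟩
      ⟨ a τ f , a* σ (a τ (a σ f)) ⟩  ≡⟨ alt-adjoint n σ (a τ f) (a τ (a σ f)) ⟨
      ⟨ a σ (a τ f) , a τ (a σ f) ⟩   ≡⟨ ⟨⟩-cong {g = a τ (a σ f)} (alt-comm n n σ τ f σ⇄τ) (λ _ → refl) ⟩
      ∥ a τ (a σ f) ∥²                ∎
      where open ≡-Reasoning

    ⟨-,0⟩ : ∀ f → ⟨ f , (λ _ → 0ℤ) ⟩ ≡ 0ℤ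
    ⟨-,0⟩ f = trans (⟨⟩-comm f _) (∫-* 0ℤ f)

    ⟨f,frame⟩ : ∀ L f → ⟨ f , frame L f ⟩ ≡ energy L f
    ⟨f,frame⟩ []      f = ⟨-,0⟩ f
    ⟨f,frame⟩ (σ ∷ L) f = trans (⟨⟩-+ʳ f (a* σ (a σ f)) (frame L f))
      (cong₂ _+_ (⟨f,a*af⟩ σ f) (⟨f,frame⟩ L f))

    ⟨a*af,frame⟩ : ∀ {σ L} f → All (σ ⇄_) L → ⟨ a* σ (a σ f) , frame L f ⟩ ≡ energy L (a σ f)
    ⟨a*af,frame⟩ {σ} {[]}    f []         = ⟨-,0⟩ (a* σ (a σ f))
    ⟨a*af,frame⟩ {σ} {τ ∷ L} f (σ⇄τ ∷ cs) =
      trans (⟨⟩-+ʳ (a* σ (a σ f)) (a* τ (a τ f)) (frame L f))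
        (cong₂ _+_ (⟨a*af,a*af⟩ {σ} {τ} f σ⇄τ) (⟨a*af,frame⟩ {σ} {L} f cs))

    -- Expanding the square: diagonal terms lose at most a factor `κ`² by the operator norm of `a*`,
    -- and off-diagonal terms are exactly `energy₂`. In normalised form S² ≤ S + 2 E₂.
    ∥frame∥²≤ : ∀ {L} f → AllPairs _⇄_ L →
                ∥ frame L f ∥² ≤ + κ * + κ * energy L f + + 2 * energy₂ L f
    ∥frame∥²≤ {[]}    f [] = ℤ.≤-reflexive (trans (⟨-,0⟩ (λ _ → 0ℤ))
      (solve 1 (λ k → con 0ℤ := k :* k :* con 0ℤ :+ con (+ 2) :* con 0ℤ) refl (+ κ)))
    ∥frame∥²≤ {σ ∷ L} f (cs ∷ css) = by-difference
      (+-nonneg (difference (∥alt∥²≤ (inverse σ) (a σ f))) (difference (∥frame∥²≤ {L} f css)))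
      (trans (cong (λ y → + κ * + κ * energy (σ ∷ L) f + + 2 * energy₂ (σ ∷ L) f - y)
          (trans (∥+∥² (a* σ (a σ f)) (frame L f))
            (cong (λ y → ∥ a* σ (a σ f) ∥² + + 2 * y + ∥ frame L f ∥²) (⟨a*af,frame⟩ {σ} {L} f cs))))
        (solve 7 (λ k A E X E₂ B Φ →
          k :* k :* (A :+ E) :+ con (+ 2) :* (X :+ E₂) :- (B :+ con (+ 2) :* X :+ Φ) :=
          (k :* k :* A :- B) :+ (k :* k :* E :+ con (+ 2) :* E₂ :- Φ)) refl
          (+ κ) ∥ a σ f ∥² (energy L f) (energy L (a σ f)) (energy₂ L f)
          ∥ a* σ (a σ f) ∥² ∥ frame L f ∥²))

    -- From 0 ≤ (1 - S)² and S² ≤ S + 2 E₂ follows S ≤ 1 + 2 E₂.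
    κ²energy≤ : ∀ {L} f → AllPairs _⇄_ L →
                + κ * + κ * energy L f ≤ + κ * + κ * (+ κ * + κ * ∥ f ∥²) + + 2 * energy₂ L f
    κ²energy≤ {L} f cs = by-difference
      (+-nonneg (completed-square (+ κ * + κ) f (frame L f)) (difference (∥frame∥²≤ f cs)))
      (trans
        (solve 5 (λ k F E E₂ Φ →
          k :* k :* (k :* k :* F) :+ con (+ 2) :* E₂ :- k :* k :* E :=
          (k :* k :* (k :* k) :* F :- con (+ 2) :* (k :* k :* E) :+ Φ) :+
          (k :* k :* E :+ con (+ 2) :* E₂ :- Φ)) refl
          (+ κ) ∥ f ∥² (energy L f) (energy₂ L f) ∥ frame L f ∥²)
        (cong (λ y → (+ κ * + κ * (+ κ * + κ) * ∥ f ∥² - + 2 * (+ κ * + κ * y) + ∥ frame L f ∥²) +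
                     (+ κ * + κ * energy L f + + 2 * energy₂ L f - ∥ frame L f ∥²))
          (sym (⟨f,frame⟩ L f))))

    -- The inequality S ≤ 1 + 2 E₂ for the rest of the list, applied to each `a σ f` and summed over
    -- σ, gives E₂ ≤ S + 2 E₃.
    κ²energy₂≤ : ∀ {L} f → AllPairs _⇄_ L →
                 + κ * + κ * energy₂ L f ≤ + κ * + κ * (+ κ * + κ * energy L f) + + 2 * energy₃ L f
    κ²energy₂≤ {[]}    f [] = ℤ.≤-reflexive
      (solve 1 (λ k → k :* k :* con 0ℤ := k :* k :* (k :* k :* con 0ℤ) :+ con (+ 2) :* con 0ℤ) refl (+ κ))
    κ²energy₂≤ {σ ∷ L} f (_ ∷ css) = by-difference
      (+-nonneg (difference (κ²energy≤ {L} (a σ f) css)) (difference (κ²energy₂≤ {L} f css)))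
      (solve 7 (λ k A E X E₂ X₂ E₃ →
        k :* k :* (k :* k :* (A :+ E)) :+ con (+ 2) :* (X₂ :+ E₃) :- k :* k :* (X :+ E₂) :=
        (k :* k :* (k :* k :* A) :+ con (+ 2) :* X₂ :- k :* k :* X) :+
        (k :* k :* (k :* k :* E) :+ con (+ 2) :* E₃ :- k :* k :* E₂)) refl
        (+ κ) ∥ a σ f ∥² (energy L f) (energy L (a σ f)) (energy₂ L f) (energy₂ L (a σ f)) (energy₃ L f))

    -- The square completed here is ∥ 3 κ² f - frame L f ∥².
    3κ⁴energy≤ : ∀ {L} f → AllPairs _⇄_ L →
      + 3 * (+ κ * + κ * (+ κ * + κ * energy L f)) ≤
      + 9 * (+ κ * + κ * (+ κ * + κ * (+ κ * + κ * ∥ f ∥²))) + + 4 * energy₃ L f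
    3κ⁴energy≤ {L} f cs = by-difference
      (+-nonneg
        (*-nonneg (0≤i*i (+ κ)) (+-nonneg (completed-square (+ 3 * (+ κ * + κ)) f (frame L f))
                                          (difference (∥frame∥²≤ f cs))))
        (*-nonneg {+ 2} (ℤ.+≤+ ℕ.z≤n) (difference (κ²energy₂≤ f cs))))
      (trans
        (solve 6 (λ k F E E₂ E₃ Φ →
          con (+ 9) :* (k :* k :* (k :* k :* (k :* k :* F))) :+ con (+ 4) :* E₃ :-
          con (+ 3) :* (k :* k :* (k :* k :* E)) :=
          k :* k :* ((con (+ 3) :* (k :* k)) :* (con (+ 3) :* (k :* k)) :* F :-
                      con (+ 2) :* (con (+ 3) :* (k :* k) :* E) :+ Φ :+
                     (k :* k :* E :+ con (+ 2) :* E₂ :- Φ)) :+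
          con (+ 2) :* (k :* k :* (k :* k :* E) :+ con (+ 2) :* E₃ :- k :* k :* E₂)) refl
          (+ κ) ∥ f ∥² (energy L f) (energy₂ L f) (energy₃ L f) ∥ frame L f ∥²)
        (cong (λ y → + κ * + κ * ((+ 3 * (+ κ * + κ)) * (+ 3 * (+ κ * + κ)) * ∥ f ∥² -
                        + 2 * (+ 3 * (+ κ * + κ) * y) + ∥ frame L f ∥² +
                        (+ κ * + κ * energy L f + + 2 * energy₂ L f - ∥ frame L f ∥²)) +
                     + 2 * (+ κ * + κ * (+ κ * + κ * energy L f) + + 2 * energy₃ L f - + κ * + κ * energy₂ L f))
          (sym (⟨f,frame⟩ L f))))

    module _ (C : ℕ) (f : Fun) where

      private
        B : ℤ
        B = + (C ℕ.* (κ ℕ.* (κ ℕ.* 1))) * + (C ℕ.* (κ ℕ.* (κ ℕ.* 1))) * ∥ f ∥²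

        step : ∀ k l {i j} → i ≤ + k * B → j ≤ + l * B → i + j ≤ + (k ℕ.+ l) * B
        step k l {i} {j} i≤ j≤ = subst (i + j ≤_)
          (trans (sym (ℤ.*-distribʳ-+ B (+ k) (+ l))) (cong (_* B) (sym (ℤ.pos-+ k l))))
          (ℤ.+-mono-≤ i≤ j≤)

      private
        energy-aa≤ : ∀ {σ₁ σ₂ L} → σ₁ ⇄ σ₂ → All (σ₁ ⇄_) L → All (σ₂ ⇄_) L →
                     All (OddRelation C σ₁ σ₂) L → energy L (a σ₂ (a σ₁ f)) ≤ + length L * B
        energy-aa≤ {L = []}     c cs₁ cs₂ []       = ℤ.≤-refl
        energy-aa≤ {σ₁} {σ₂} {σ₃ ∷ L} c₁₂ (c₁₃ ∷ cs₁) (c₂₃ ∷ cs₂) (r ∷ rs) = step 1 (length L)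
          (subst (∥ a σ₃ (a σ₂ (a σ₁ f)) ∥² ≤_) (sym (ℤ.*-identityˡ B))
            (subst (_≤ B) (∥∥²-cong reorder)
              (energy≤ (OddRelation⇒Bounded {σ₁} {σ₂} {σ₃} c₁₂ c₁₃ c₂₃ f r))))
          (energy-aa≤ {σ₁} {σ₂} c₁₂ cs₁ cs₂ rs)
          where
          reorder : a σ₁ (a σ₂ (a σ₃ f)) ≗ a σ₃ (a σ₂ (a σ₁ f))
          reorder x = trans (alt-cong n σ₁ (alt-comm n n σ₂ σ₃ f c₂₃) x)
            (trans (alt-comm n n σ₁ σ₃ (a σ₂ f) c₁₃ x)
                   (alt-cong n σ₃ (alt-comm n n σ₁ σ₂ f c₁₂) x))

        energy₂-a≤ : ∀ {σ₁ L} → All (σ₁ ⇄_) L → AllPairs _⇄_ L →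
                     AllPairs (OddRelation C σ₁) L → energy₂ L (a σ₁ f) ≤ + pairs (length L) * B
        energy₂-a≤ {L = []}          cs css [] = ℤ.≤-refl
        energy₂-a≤ {σ₁} {L = σ₂ ∷ L} (c₁₂ ∷ cs₁) (cs₂ ∷ css) (rs ∷ rss) = step (length L) (pairs (length L))
          (energy-aa≤ {σ₁} {σ₂} c₁₂ cs₁ cs₂ rs) (energy₂-a≤ {σ₁} cs₁ css rss)

      energy₃≤ : ∀ {L} → AllPairs _⇄_ L → AllTriples (OddRelation C) L →
                 energy₃ L f ≤ + triples (length L) * B
      energy₃≤ {[]}    css []  = ℤ.≤-refl
      energy₃≤ {σ ∷ L} (cs ∷ css) (rss ∷ rsss) = step (pairs (length L)) (triples (length L))
        (energy₂-a≤ {σ} cs css rss) (energy₃≤ css rsss)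

      -- Each triple contributes at most C² `κ`⁴, so after cancelling `κ`⁴ the relation error no
      -- longer depends on n, while the main term is 9 `κ`².
      energy-bound : ∀ {L} → AllPairs _⇄_ L → AllTriples (OddRelation C) L →
        + 3 * energy L f ≤ (+ 9 * (+ κ * + κ) + + 4 * + triples (length L) * (+ C * + C)) * ∥ f ∥²
      energy-bound {L} cs rs = ℤ.*-cancelˡ-≤-pos _ _ (+ κ * + κ * (+ κ * + κ))
        (by-difference
          (+-nonneg (difference (3κ⁴energy≤ f cs))
            (*-nonneg {+ 4} (ℤ.+≤+ ℕ.z≤n) (difference (energy₃≤ cs rs))))
          (trans
            (solve 6 (λ k F E E₃ C t →
              (k :* k :* (k :* k)) :* ((con (+ 9) :* (k :* k) :+ con (+ 4) :* t :* (C :* C)) :* F) :-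
              (k :* k :* (k :* k)) :* (con (+ 3) :* E) :=
              (con (+ 9) :* (k :* k :* (k :* k :* (k :* k :* F))) :+ con (+ 4) :* E₃ :-
                con (+ 3) :* (k :* k :* (k :* k :* E))) :+
              con (+ 4) :* (t :* ((C :* (k :* (k :* con (+ 1)))) :* (C :* (k :* (k :* con (+ 1)))) :* F) :- E₃)) refl
              (+ κ) ∥ f ∥² (energy L f) (energy₃ L f) (+ C) (+ triples (length L)))
            (cong (λ c → (+ 9 * (+ κ * + κ * (+ κ * + κ * (+ κ * + κ * ∥ f ∥²))) + + 4 * energy₃ L f -
                            + 3 * (+ κ * + κ * (+ κ * + κ * energy L f))) +
                         + 4 * (+ triples (length L) * (c * c * ∥ f ∥²) - energy₃ L f))
              (sym cast))))
        where
        cast : + (C ℕ.* (κ ℕ.* (κ ℕ.* 1))) ≡ + C * (+ κ * (+ κ * + 1))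
        cast = trans (ℤ.pos-* C _) (cong (+ C *_) (trans (ℤ.pos-* κ _) (cong (+ κ *_) (ℤ.pos-* κ 1))))

-- Vectors with natural coordinates, signs, and odd relations

Vector : Set
Vector = ℕ × ℕ

infixl 6 _⊕_
infixl 7 _•_

_⊕_ : Vector → Vector → Vector
(a , b) ⊕ (c , d) = a ℕ.+ c , b ℕ.+ d

_•_ : ℕ → Vector → Vector
k • (a , b) = k ℕ.* a , k ℕ.* b

sgn : ℕ → ℤ
sgn zero    = 1ℤ
sgn (suc n) = - sgn n

sgn-+ : ∀ m n → sgn (m ℕ.+ n) ≡ sgn m * sgn n
sgn-+ zero    n = sym (ℤ.*-identityˡ (sgn n))
sgn-+ (suc m) n = trans (cong -_ (sgn-+ m n)) (ℤ.neg-distribˡ-* (sgn m) (sgn n))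

sgn² : ∀ n → sgn n * sgn n ≡ 1ℤ
sgn² zero    = refl
sgn² (suc n) = trans (solve 1 (λ a → :- a :* :- a := a :* a) refl (sgn n)) (sgn² n)

sgn-odd : ∀ m → m % 2 ≡ 1 → sgn m ≡ -1ℤ
sgn-odd m odd = trans (cong sgn (trans (m≡m%n+[m/n]*n m 2) (cong (ℕ._+ m / 2 ℕ.* 2) odd)))
  (cong -_ (even (m / 2)))
  where
  even : ∀ k → sgn (k ℕ.* 2) ≡ 1ℤ
  even zero    = refl
  even (suc k) = trans (ℤ.neg-involutive (sgn (k ℕ.* 2))) (even k)

sgn-opposite : ∀ m n → (m ℕ.+ n) % 2 ≡ 1 → sgn m ≡ - sgn n
sgn-opposite m n odd = begin
  sgn m                     ≡⟨ ℤ.*-identityʳ (sgn m) ⟨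
  sgn m * 1ℤ                ≡⟨ cong (sgn m *_) (sgn² n) ⟨
  sgn m * (sgn n * sgn n)   ≡⟨ ℤ.*-assoc (sgn m) (sgn n) (sgn n) ⟨
  sgn m * sgn n * sgn n     ≡⟨ cong (_* sgn n) (trans (sym (sgn-+ m n)) (sgn-odd (m ℕ.+ n) odd)) ⟩
  -1ℤ * sgn n               ≡⟨ ℤ.-1*i≡-i (sgn n) ⟩
  - sgn n                   ∎
  where open ≡-Reasoning

Coefficients : Set
Coefficients = ℕ × ℕ × ℕ

-- An integral relation with its negative coefficients moved to the other side, which leaves the
-- parity of the coefficient sum unchanged. The six successors in the weight are the factors p + 1
-- from `Bounded-alt`.
OddBalance : ℕ → Vector → Vector → Vector → Coefficients × Coefficients → Set
OddBalance C u v w ((p₁ , p₂ , p₃) , (q₁ , q₂ , q₃)) =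
  (p₁ • u ⊕ p₂ • v ⊕ p₃ • w ≡ q₁ • u ⊕ q₂ • v ⊕ q₃ • w) ×
  ((p₁ ℕ.+ p₂ ℕ.+ p₃) ℕ.+ (q₁ ℕ.+ q₂ ℕ.+ q₃)) % 2 ≡ 1 ×
  (suc p₁ ℕ.+ suc p₂ ℕ.+ suc p₃) ℕ.+ (suc q₁ ℕ.+ suc q₂ ℕ.+ suc q₃) ℕ.≤ C

OddlyRelated : ℕ → Vector → Vector → Vector → Set
OddlyRelated C u v w = ∃ (OddBalance C u v w)

-- Alternating and plain sums of sequences

alternating total : ℕ → (ℕ → ℤ) → ℤ
alternating zero    u = 0ℤ
alternating (suc n) u = u 0 - alternating n (u ∘ suc)
total zero    u = 0ℤ
total (suc n) u = u 0 + total n (u ∘ suc)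

private
  parity-suc : ∀ j → parity j ≡ 1ℙ → parity (suc j) ≡ 0ℙ
  parity-suc (suc zero)    eq = refl
  parity-suc (suc (suc j)) eq = parity-suc j eq

  parity-suc′ : ∀ j → parity j ≡ 0ℙ → parity (suc j) ≡ 1ℙ
  parity-suc′ zero          eq = refl
  parity-suc′ (suc (suc j)) eq = parity-suc′ j eq

  -- The bracket is twice the sum over even places, and with a minus sign twice the sum over odd
  -- places. Peeling off `u 0` exchanges the two cases, hence the mutual recursion.
  total+alternating≡0 : ∀ c n u → (∀ j → j ℕ.< n → parity j ≡ 0ℙ → c * u j ≡ 0ℤ) →
                        c * (total n u + alternating n u) ≡ 0ℤ
  total-alternating≡0 : ∀ c n u → (∀ j → j ℕ.< n → parity j ≡ 1ℙ → c * u j ≡ 0ℤ) →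
                        c * (total n u - alternating n u) ≡ 0ℤ
  total+alternating≡0 c zero    u vanish = ℤ.*-zeroʳ c
  total+alternating≡0 c (suc n) u vanish = begin
    c * (u 0 + t + (u 0 - a))        ≡⟨ solve 4 (λ c u t a → c :* (u :+ t :+ (u :- a)) := (c :* u :+ c :* u) :+ c :* (t :- a)) refl c (u 0) t a ⟩
    c * u 0 + c * u 0 + c * (t - a)  ≡⟨ cong₂ (λ x y → x + x + y) (vanish 0 ℕ.z<s refl)
                                          (total-alternating≡0 c n (u ∘ suc) λ j j<n odd → vanish (suc j) (ℕ.s<s j<n) (parity-suc j odd)) ⟩
    0ℤ                               ∎
    where
    open ≡-Reasoning
    t = total n (u ∘ suc)
    a = alternating n (u ∘ suc)
  total-alternating≡0 c zero    u vanish = ℤ.*-zeroʳ c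
  total-alternating≡0 c (suc n) u vanish = begin
    c * (u 0 + t - (u 0 - a))        ≡⟨ solve 4 (λ c u t a → c :* (u :+ t :- (u :- a)) := c :* (t :+ a)) refl c (u 0) t a ⟩
    c * (t + a)                      ≡⟨ total+alternating≡0 c n (u ∘ suc) (λ j j<n even → vanish (suc j) (ℕ.s<s j<n) (parity-suc′ j even)) ⟩
    0ℤ                               ∎
    where
    open ≡-Reasoning
    t = total n (u ∘ suc)
    a = alternating n (u ∘ suc)

-- With E and O the sums over even and odd places, both sides are
-- (E ∓ O)², and E O = 0.
alternating²≡total² : ∀ n u →
  (∀ i d → parity d ≡ 1ℙ → i ℕ.+ d ℕ.< n → u i * u (i ℕ.+ d) ≡ 0ℤ) →
  alternating n u * alternating n u ≡ total n u * total n u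
alternating²≡total² zero    u vanish = refl
alternating²≡total² (suc n) u vanish = begin
  (u 0 - a) * (u 0 - a)
    ≡⟨ solve 3 (λ u t a → (u :- a) :* (u :- a) := u :* u :+ con (+ 2) :* (u :* t) :+ a :* a :- con (+ 2) :* (u :* (t :+ a))) refl (u 0) t a ⟩
  u 0 * u 0 + + 2 * (u 0 * t) + a * a - + 2 * (u 0 * (t + a))
    ≡⟨ cong₂ (λ x y → u 0 * u 0 + + 2 * (u 0 * t) + x - + 2 * y)
         (alternating²≡total² n (u ∘ suc) λ i d odd i+d<n → vanish (suc i) d odd (ℕ.s<s i+d<n))
         (total+alternating≡0 (u 0) n (u ∘ suc) λ j j<n even → vanish 0 (suc j) (parity-suc′ j even) (ℕ.s<s j<n)) ⟩
  u 0 * u 0 + + 2 * (u 0 * t) + t * t - + 2 * 0ℤ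
    ≡⟨ solve 2 (λ u t → u :* u :+ con (+ 2) :* (u :* t) :+ t :* t :- con (+ 2) :* con 0ℤ := (u :+ t) :* (u :+ t)) refl (u 0) t ⟩
  (u 0 + t) * (u 0 + t) ∎
  where
  open ≡-Reasoning
  t = total n (u ∘ suc)
  a = alternating n (u ∘ suc)

-- Sums over finite sets

sum-nonneg : ∀ {k} (t : Fin k → ℤ) → (∀ i → 0ℤ ≤ t i) → 0ℤ ≤ sum t
sum-nonneg {zero}  t 0≤t = ℤ.≤-refl
sum-nonneg {suc k} t 0≤t = +-nonneg (0≤t zero) (sum-nonneg (t ∘ suc) (0≤t ∘ suc))

sum-mono : ∀ {k} {s t : Fin k → ℤ} → (∀ i → s i ≤ t i) → sum s ≤ sum t
sum-mono {zero}  s≤t = ℤ.≤-refl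
sum-mono {suc k} s≤t = ℤ.+-mono-≤ (s≤t zero) (sum-mono (s≤t ∘ suc))

-- 0 ≤ Σ (c - tᵢ)², expanded.
private
  spread : ∀ {k} (t : Fin k → ℤ) c →
           0ℤ ≤ + k * (c * c) - + 2 * (c * sum t) + ∑[ i < k ] (t i * t i)
  spread {zero}  t c = ℤ.≤-reflexive
    (solve 1 (λ c → con 0ℤ := con 0ℤ :* (c :* c) :- con (+ 2) :* (c :* con 0ℤ) :+ con 0ℤ) refl c)
  spread {suc k} t c = subst (0ℤ ≤_)
    (trans
      (solve 5 (λ k c x S Q →
        (c :- x) :* (c :- x) :+ (k :* (c :* c) :- con (+ 2) :* (c :* S) :+ Q) :=
        (con 1ℤ :+ k) :* (c :* c) :- con (+ 2) :* (c :* (x :+ S)) :+ (x :* x :+ Q)) refl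
        (+ k) c (t zero) (sum (t ∘ suc)) (∑[ i < k ] (t (suc i) * t (suc i))))
      (cong (λ m → m * (c * c) - + 2 * (c * sum t) + ∑[ i < suc k ] (t i * t i)) (sym (ℤ.pos-+ 1 k))))
    (+-nonneg (0≤i*i (c - t zero)) (spread (t ∘ suc) c))

-- A further term x enlarges the difference of the sides by Σ (x - tᵢ)², which is `spread` with c =
-- x.
cauchy-schwarz : ∀ {k} (t : Fin k → ℤ) → sum t * sum t ≤ + k * ∑[ i < k ] (t i * t i)
cauchy-schwarz {zero}  t = ℤ.≤-refl
cauchy-schwarz {suc k} t = by-difference
  (+-nonneg (spread (t ∘ suc) (t zero)) (difference (cauchy-schwarz (t ∘ suc))))
  (trans (cong (λ m → m * ∑[ i < suc k ] (t i * t i) - sum t * sum t) (ℤ.pos-+ 1 k))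
    (solve 4 (λ k x S Q →
      (con 1ℤ :+ k) :* (x :* x :+ Q) :- (x :+ S) :* (x :+ S) :=
      (k :* (x :* x) :- con (+ 2) :* (x :* S) :+ Q) :+ (k :* Q :- S :* S)) refl
      (+ k) (t zero) (sum (t ∘ suc)) (∑[ i < k ] (t (suc i) * t (suc i)))))

indicator : ∀ {k} → Fin k → Fin k → ℤ
indicator zero    zero    = 1ℤ
indicator zero    (suc j) = 0ℤ
indicator (suc i) zero    = 0ℤ
indicator (suc i) (suc j) = indicator i j

indicator² : ∀ {k} (i j : Fin k) → indicator i j * indicator i j ≡ indicator i j
indicator² zero    zero    = refl
indicator² zero    (suc j) = refl
indicator² (suc i) zero    = refl
indicator² (suc i) (suc j) = indicator² i j

indicator-disjoint : ∀ {k} (i : Fin k) {j l} → j ≢ l → indicator i j * indicator i l ≡ 0ℤ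
indicator-disjoint zero    {zero}  {zero}  j≢l = contradiction refl j≢l
indicator-disjoint zero    {zero}  {suc l} j≢l = refl
indicator-disjoint zero    {suc j}         j≢l = refl
indicator-disjoint (suc i) {zero}          j≢l = refl
indicator-disjoint (suc i) {suc j} {zero}  j≢l = ℤ.*-zeroʳ (indicator i j)
indicator-disjoint (suc i) {suc j} {suc l} j≢l = indicator-disjoint i (j≢l ∘ cong suc)

∑-indicator : ∀ {k} (j : Fin k) → ∑[ i < k ] indicator i j ≡ 1ℤ
∑-indicator {suc k} zero    = cong (λ s → 1ℤ + s) (sum-replicate-zero k)
∑-indicator {suc k} (suc j) = trans (ℤ.+-identityˡ _) (∑-indicator j)

below : ∀ {n} → ℕ → Fin n → ℤ
below zero    i       = 0ℤ
below (suc m) zero    = 1ℤ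
below (suc m) (suc i) = below m i

∑-below : ∀ {n} m → m ℕ.≤ n → ∑[ i < n ] below m i ≡ + m
∑-below {n}     zero    m≤n = sum-replicate-zero n
∑-below {suc n} (suc m) (ℕ.s≤s m≤n) = cong (λ s → 1ℤ + s) (∑-below m m≤n)

-- The discrete torus

module Torus (N : ℕ) .{{N≢0 : NonZero N}} where

  infixl 6 _⊞_ _⊞₂_

  _⊞_ : Fin N → ℕ → Fin N
  i ⊞ a = (toℕ i ℕ.+ a) mod N

  toℕ-⊞ : ∀ i a → toℕ (i ⊞ a) ≡ (toℕ i ℕ.+ a) % N
  toℕ-⊞ i a = Fin.toℕ-fromℕ< (m%n<n (toℕ i ℕ.+ a) N)

  ⊞-⊞ : ∀ i a b → i ⊞ a ⊞ b ≡ i ⊞ (a ℕ.+ b)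
  ⊞-⊞ i a b = Fin.toℕ-injective (begin
    toℕ (i ⊞ a ⊞ b)                          ≡⟨ toℕ-⊞ (i ⊞ a) b ⟩
    (toℕ (i ⊞ a) ℕ.+ b) % N                  ≡⟨ cong (λ m → (m ℕ.+ b) % N) (toℕ-⊞ i a) ⟩
    (m % N ℕ.+ b) % N                        ≡⟨ %-distribˡ-+ (m % N) b N ⟩
    (m % N % N ℕ.+ b % N) % N                ≡⟨ cong (λ k → (k ℕ.+ b % N) % N) (m%n%n≡m%n m N) ⟩
    (m % N ℕ.+ b % N) % N                    ≡⟨ %-distribˡ-+ m b N ⟨
    (m ℕ.+ b) % N                            ≡⟨ cong (_% N) (ℕ.+-assoc (toℕ i) a b) ⟩
    (toℕ i ℕ.+ (a ℕ.+ b)) % N                ≡⟨ toℕ-⊞ i (a ℕ.+ b) ⟨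
    toℕ (i ⊞ (a ℕ.+ b))                      ∎)
    where
    open ≡-Reasoning
    m = toℕ i ℕ.+ a

  ⊞-multiple : ∀ i a → i ⊞ a ℕ.* N ≡ i
  ⊞-multiple i a = Fin.toℕ-injective (trans (toℕ-⊞ i (a ℕ.* N))
    (trans ([m+kn]%n≡m%n (toℕ i) a N) (m<n⇒m%n≡m (Fin.toℕ<n i))))

  toℕ-⊞-small : ∀ i {a} → toℕ i ℕ.+ a ℕ.< N → toℕ (i ⊞ a) ≡ toℕ i ℕ.+ a
  toℕ-⊞-small i {a} i+a<N = trans (toℕ-⊞ i a) (m<n⇒m%n≡m i+a<N)

  -- The negative of a modulo N, as a (N - 1), so that shifts back are again shifts by natural
  -- numbers.
  opp : ℕ → ℕ
  opp a = a ℕ.* ℕ.pred N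

  +-opp : ∀ a → a ℕ.+ opp a ≡ a ℕ.* N
  +-opp a = trans (sym (ℕ.*-suc a (ℕ.pred N))) (cong (a ℕ.*_) (ℕ.suc-pred N))

  ⊞-opp : ∀ i a → i ⊞ a ⊞ opp a ≡ i
  ⊞-opp i a = trans (⊞-⊞ i a (opp a)) (trans (cong (i ⊞_) (+-opp a)) (⊞-multiple i a))

  opp-⊞ : ∀ i a → i ⊞ opp a ⊞ a ≡ i
  opp-⊞ i a = trans (⊞-⊞ i (opp a) a)
    (trans (cong (i ⊞_) (trans (ℕ.+-comm (opp a) a) (+-opp a))) (⊞-multiple i a))

  ∑-⊞ : ∀ a (f : Fin N → ℤ) → ∑[ i < N ] f (i ⊞ a) ≡ ∑[ i < N ] f i
  ∑-⊞ a f = sym (∑-permute f (permutation (_⊞ a) (_⊞ opp a) (λ i → opp-⊞ i a) (λ i → ⊞-opp i a)))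

  X : Set
  X = Fin N × Fin N

  _⊞₂_ : X → Vector → X
  (i , j) ⊞₂ (a , b) = i ⊞ a , j ⊞ b

  ⊞₂-⊞₂ : ∀ x u v → x ⊞₂ u ⊞₂ v ≡ x ⊞₂ (u ⊕ v)
  ⊞₂-⊞₂ (i , j) (a , b) (c , d) = cong₂ _,_ (⊞-⊞ i a c) (⊞-⊞ j b d)

  ⊞₂-zero : ∀ x v → x ⊞₂ 0 • v ≡ x
  ⊞₂-zero (i , j) v = cong₂ _,_ (⊞-multiple i 0) (⊞-multiple j 0)

  ∫ : (X → ℤ) → ℤ
  ∫ f = ∑[ i < N ] ∑[ j < N ] f (i , j)

  ∫-cong : ∀ {f g : X → ℤ} → f ≗ g → ∫ f ≡ ∫ g
  ∫-cong f≗g = sum-cong-≗ {N} (λ i → sum-cong-≗ {N} (λ j → f≗g (i , j)))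

  ∫-+ : ∀ f g → ∫ (λ x → f x + g x) ≡ ∫ f + ∫ g
  ∫-+ f g = trans (sum-cong-≗ {N} (λ i → ∑-distrib-+ {N} (λ j → f (i , j)) (λ j → g (i , j))))
    (∑-distrib-+ {N} (λ i → ∑[ j < N ] f (i , j)) (λ i → ∑[ j < N ] g (i , j)))

  ∫-* : ∀ c f → ∫ (λ x → c * f x) ≡ c * ∫ f
  ∫-* c f = sym (trans (*-distribˡ-sum {N} c (λ i → ∑[ j < N ] f (i , j)))
    (sum-cong-≗ {N} (λ i → *-distribˡ-sum {N} c (λ j → f (i , j)))))

  ∫-nonneg : ∀ f → (∀ x → 0ℤ ≤ f x) → 0ℤ ≤ ∫ f
  ∫-nonneg f 0≤f = sum-nonneg {N} _ (λ i → sum-nonneg {N} _ (λ j → 0≤f (i , j)))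

  ∫-mono : ∀ {f g : X → ℤ} → (∀ x → f x ≤ g x) → ∫ f ≤ ∫ g
  ∫-mono f≤g = sum-mono {N} (λ i → sum-mono {N} (λ j → f≤g (i , j)))

  ∫-∑ : ∀ {k} (f : Fin k → X → ℤ) → ∫ (λ x → ∑[ c < k ] f c x) ≡ ∑[ c < k ] ∫ (f c)
  ∫-∑ {zero}  f = ∫-* 0ℤ (λ _ → 0ℤ)
  ∫-∑ {suc k} f = trans (∫-+ (f zero) (λ x → ∑[ c < k ] f (suc c) x)) (cong (λ s → ∫ (f zero) + s) (∫-∑ (f ∘ suc)))

  ∫-product : ∀ (f g : Fin N → ℤ) → ∫ (λ (i , j) → f i * g j) ≡ sum f * sum g
  ∫-product f g = begin
    ∑[ i < N ] ∑[ j < N ] (f i * g j)  ≡⟨ sum-cong-≗ {N} (λ i → sym (*-distribˡ-sum {N} (f i) g)) ⟩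
    ∑[ i < N ] (f i * sum g)           ≡⟨ sum-cong-≗ {N} (λ i → ℤ.*-comm (f i) (sum g)) ⟩
    ∑[ i < N ] (sum g * f i)           ≡⟨ *-distribˡ-sum {N} (sum g) f ⟨
    sum g * sum f                      ≡⟨ ℤ.*-comm (sum g) (sum f) ⟩
    sum f * sum g                      ∎
    where open ≡-Reasoning

  open Energy {X} ∫ ∫-cong ∫-+ ∫-* ∫-nonneg public

  shift : Vector → Symmetry
  shift (a , b) = record
    { to      = _⊞₂ (a , b)
    ; from    = _⊞₂ (opp a , opp b)
    ; to-from = λ (i , j) → cong₂ _,_ (opp-⊞ i a) (opp-⊞ j b)
    ; from-to = λ (i , j) → cong₂ _,_ (⊞-opp i a) (⊞-opp j b)
    ; ∫-to    = λ f → trans (sum-cong-≗ {N} (λ i → ∑-⊞ b (λ j → f (i ⊞ a , j))))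
                            (∑-⊞ a (λ i → ∑[ j < N ] f (i , j)))
    }

  shift-⇄ : ∀ u v → shift u ⇄ shift v
  shift-⇄ u@(a , b) v@(c , d) x = trans (⊞₂-⊞₂ x v u)
    (trans (cong (x ⊞₂_) (cong₂ _,_ (ℕ.+-comm c a) (ℕ.+-comm d b))) (sym (⊞₂-⊞₂ x u v)))

  twist-shift : ∀ p v f x → twist p (shift v) f x ≡ sgn p * f (x ⊞₂ p • v)
  twist-shift zero    v f x = trans (cong f (sym (⊞₂-zero x v))) (sym (ℤ.*-identityˡ _))
  twist-shift (suc p) v f x = begin
    - twist p (shift v) f (x ⊞₂ v)          ≡⟨ cong -_ (twist-shift p v f (x ⊞₂ v)) ⟩
    - (sgn p * f (x ⊞₂ v ⊞₂ p • v))         ≡⟨ ℤ.neg-distribˡ-* (sgn p) _ ⟩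
    sgn (suc p) * f (x ⊞₂ v ⊞₂ p • v)       ≡⟨ cong (λ y → sgn (suc p) * f y) (⊞₂-⊞₂ x v (p • v)) ⟩
    sgn (suc p) * f (x ⊞₂ suc p • v)        ∎
    where open ≡-Reasoning

  twist³-shift : ∀ p₁ p₂ p₃ u v w f x →
    twist p₁ (shift u) (twist p₂ (shift v) (twist p₃ (shift w) f)) x ≡
    sgn (p₁ ℕ.+ p₂ ℕ.+ p₃) * f (x ⊞₂ (p₁ • u ⊕ p₂ • v ⊕ p₃ • w))
  twist³-shift p₁ p₂ p₃ u v w f x = begin
    twist p₁ (shift u) (twist p₂ (shift v) (twist p₃ (shift w) f)) x
      ≡⟨ twist-shift p₁ u _ x ⟩
    sgn p₁ * twist p₂ (shift v) (twist p₃ (shift w) f) (x ⊞₂ p₁ • u)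
      ≡⟨ cong (sgn p₁ *_) (twist-shift p₂ v _ _) ⟩
    sgn p₁ * (sgn p₂ * twist p₃ (shift w) f (x ⊞₂ p₁ • u ⊞₂ p₂ • v))
      ≡⟨ cong (λ y → sgn p₁ * (sgn p₂ * y)) (twist-shift p₃ w f _) ⟩
    sgn p₁ * (sgn p₂ * (sgn p₃ * f y))
      ≡⟨ solve 4 (λ a b c d → a :* (b :* (c :* d)) := a :* b :* c :* d) refl (sgn p₁) (sgn p₂) (sgn p₃) (f y) ⟩
    sgn p₁ * sgn p₂ * sgn p₃ * f y
      ≡⟨ cong₂ _*_ (trans (cong (_* sgn p₃) (sym (sgn-+ p₁ p₂))) (sym (sgn-+ (p₁ ℕ.+ p₂) p₃)))
           (cong f (trans (cong (_⊞₂ p₃ • w) (⊞₂-⊞₂ x (p₁ • u) (p₂ • v))) (⊞₂-⊞₂ x _ (p₃ • w)))) ⟩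
    sgn (p₁ ℕ.+ p₂ ℕ.+ p₃) * f (x ⊞₂ (p₁ • u ⊕ p₂ • v ⊕ p₃ • w)) ∎
    where
    open ≡-Reasoning
    y = x ⊞₂ p₁ • u ⊞₂ p₂ • v ⊞₂ p₃ • w

  OddlyRelated⇒OddRelation : ∀ {C u v w} → OddlyRelated C u v w → OddRelation C (shift u) (shift v) (shift w)
  OddlyRelated⇒OddRelation {C} {u} {v} {w} (((p₁ , p₂ , p₃) , (q₁ , q₂ , q₃)) , balance , odd , weight) = record
    { p₁ = p₁ ; p₂ = p₂ ; p₃ = p₃ ; q₁ = q₁ ; q₂ = q₂ ; q₃ = q₃
    ; weight   = weight
    ; opposite = λ f x → begin
        twist p₁ (shift u) (twist p₂ (shift v) (twist p₃ (shift w) f)) x  ≡⟨ twist³-shift p₁ p₂ p₃ u v w f x ⟩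
        sgn p * f (x ⊞₂ (p₁ • u ⊕ p₂ • v ⊕ p₃ • w))                      ≡⟨ cong₂ (λ s z → s * f (x ⊞₂ z)) (sgn-opposite p q odd) balance ⟩
        - sgn q * f (x ⊞₂ (q₁ • u ⊕ q₂ • v ⊕ q₃ • w))                    ≡⟨ ℤ.neg-distribˡ-* (sgn q) _ ⟨
        - (sgn q * f (x ⊞₂ (q₁ • u ⊕ q₂ • v ⊕ q₃ • w)))                  ≡⟨ cong -_ (twist³-shift q₁ q₂ q₃ u v w f x) ⟨
        - twist q₁ (shift u) (twist q₂ (shift v) (twist q₃ (shift w) f)) x ∎
    }
    where
    open ≡-Reasoning
    p = p₁ ℕ.+ p₂ ℕ.+ p₃
    q = q₁ ℕ.+ q₂ ℕ.+ q₃

  alt-shift : ∀ n v f x → alt n (shift v) f x ≡ alternating n (λ j → f (x ⊞₂ j • v))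
  alt-shift zero    v f x = refl
  alt-shift (suc n) v f x = cong₂ _-_ (cong f (sym (⊞₂-zero x v)))
    (trans (alt-shift n v f (x ⊞₂ v)) (alternating-cong n (λ j → cong f (⊞₂-⊞₂ x v (j • v)))))
    where
    alternating-cong : ∀ n {u u′ : ℕ → ℤ} → u ≗ u′ → alternating n u ≡ alternating n u′
    alternating-cong zero    u≗ = refl
    alternating-cong (suc n) u≗ = cong₂ _-_ (u≗ 0) (alternating-cong n (u≗ ∘ suc))

  -- Colourings

  Alternates : ∀ {k} → ℕ → Vector → (X → Fin k) → X → Set
  Alternates n v c x = ∀ i d → parity d ≡ 1ℙ → i ℕ.+ d ℕ.< n → c (x ⊞₂ i • v) ≢ c (x ⊞₂ (i ℕ.+ d) • v)

  -- Starting points from which n steps are meant to stay inside the square; M will leave a margin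
  -- for that.
  Interior : ℕ → X → Set
  Interior M (i , j) = toℕ i ℕ.< M × toℕ j ℕ.< M

  module _ {k : ℕ} (c : X → Fin k) where

    colour-class : Fin k → Fun
    colour-class a x = indicator a (c x)

    ∑-total : ∀ n (y : ℕ → X) → ∑[ a < k ] total n (λ j → colour-class a (y j)) ≡ + n
    ∑-total zero    y = sum-replicate-zero k
    ∑-total (suc n) y = begin
      ∑[ a < k ] (colour-class a (y 0) + total n (λ j → colour-class a (y (suc j))))
        ≡⟨ ∑-distrib-+ {k} (λ a → colour-class a (y 0)) _ ⟩
      ∑[ a < k ] colour-class a (y 0) + ∑[ a < k ] total n (λ j → colour-class a (y (suc j)))
        ≡⟨ cong₂ _+_ (∑-indicator (c (y 0))) (∑-total n (y ∘ suc)) ⟩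
      1ℤ + + n ∎
      where open ≡-Reasoning

    -- On the line each colour keeps to one parity, so its squared alternating sum is its squared
    -- count. The k counts add up to n, and Cauchy-Schwarz applies.
    n²≤k∑alt² : ∀ n v x → Alternates n v c x →
      + n * + n ≤ + k * ∑[ a < k ] (alt n (shift v) (colour-class a) x * alt n (shift v) (colour-class a) x)
    n²≤k∑alt² n v x alternates = subst₂ (λ S Q → S * S ≤ + k * Q) (∑-total n y)
      (sum-cong-≗ {k} (λ a → sym (trans (cong (λ z → z * z) (alt-shift n v (colour-class a) x))
        (alternating²≡total² n _ λ i d odd i+d<n → indicator-disjoint a (alternates i d odd i+d<n)))))
      (cauchy-schwarz (λ a → total n (λ j → colour-class a (y j))))
      where
      y : ℕ → X
      y j = x ⊞₂ j • v

    module _ {M n : ℕ} (M≤N : M ℕ.≤ N) where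

      private
        below-view : ∀ {l m} (i : Fin l) → (toℕ i ℕ.< m → 1ℤ ≡ below m i) × (¬ toℕ i ℕ.< m → 0ℤ ≡ below m i)
        below-view {m = zero}  i       = (λ ()) , λ _ → refl
        below-view {m = suc m} zero    = (λ _ → refl) , λ 0≮ → contradiction ℕ.z<s 0≮
        below-view {m = suc m} (suc i) = (λ lt → proj₁ (below-view {m = m} i) (ℕ.s<s⁻¹ lt)) ,
                                         (λ nlt → proj₂ (below-view {m = m} i) (nlt ∘ ℕ.s<s))

      -- Off the interior the left integrand is 0 and the right one nonnegative, so the pointwise
      -- estimate extends to the whole torus and can be integrated.
      M²n²≤k∑∥alt∥² : ∀ v → (∀ x → Interior M x → Alternates n v c x) →
        + M * + M * (+ n * + n) ≤ + k * ∑[ a < k ] ∥ alt n (shift v) (colour-class a) ∥²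
      M²n²≤k∑∥alt∥² v alternates = subst₂ _≤_
        (trans (∫-* (+ n * + n) (λ (i , j) → below M i * below M j))
          (trans (cong (+ n * + n *_) (trans (∫-product (below M) (below M))
              (cong₂ _*_ (∑-below M M≤N) (∑-below M M≤N))))
            (ℤ.*-comm (+ n * + n) (+ M * + M))))
        (trans (∫-* (+ k) (λ x → ∑[ a < k ] sq a x)) (cong (+ k *_) (∫-∑ sq)))
        (∫-mono pointwise)
        where
        sq : Fin k → X → ℤ
        sq a x = alt n (shift v) (colour-class a) x * alt n (shift v) (colour-class a) x

        0≤rhs : ∀ x → 0ℤ ≤ + k * ∑[ a < k ] sq a x
        0≤rhs x = *-nonneg {+ k} (ℤ.+≤+ ℕ.z≤n) (sum-nonneg {k} _ (λ a → 0≤i*i (alt n (shift v) (colour-class a) x)))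

        pointwise : ∀ x → + n * + n * (below M (proj₁ x) * below M (proj₂ x)) ≤ + k * ∑[ a < k ] sq a x
        pointwise x@(i , j) with toℕ i ℕ.<? M | toℕ j ℕ.<? M
        ... | yes i<M | yes j<M = subst (_≤ + k * ∑[ a < k ] sq a x)
          (trans (sym (ℤ.*-identityʳ (+ n * + n)))
            (cong₂ (λ p q → + n * + n * (p * q)) (proj₁ (below-view i) i<M) (proj₁ (below-view j) j<M)))
          (n²≤k∑alt² n v x (alternates x (i<M , j<M)))
        ... | yes i<M | no j≮M = subst (_≤ + k * ∑[ a < k ] sq a x)
          (trans (sym (trans (cong (+ n * + n *_) (ℤ.*-zeroʳ (below M i))) (ℤ.*-zeroʳ (+ n * + n))))
            (cong (λ q → + n * + n * (below M i * q)) (proj₂ (below-view j) j≮M)))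
          (0≤rhs x)
        ... | no i≮M | _ = subst (_≤ + k * ∑[ a < k ] sq a x)
          (trans (sym (ℤ.*-zeroʳ (+ n * + n)))
            (cong (λ p → + n * + n * (p * below M j)) (proj₂ (below-view i) i≮M)))
          (0≤rhs x)

      ∑-energy : ∀ L → All (λ v → ∀ x → Interior M x → Alternates n v c x) L →
        + length L * (+ M * + M * (+ n * + n)) ≤ + k * ∑[ a < k ] energy n (map shift L) (colour-class a)
      ∑-energy []      []         = ℤ.≤-reflexive (sym (trans (cong (+ k *_) (sum-replicate-zero k)) (ℤ.*-zeroʳ (+ k))))
      ∑-energy (v ∷ L) (alt ∷ as) = subst₂ _≤_
        (trans (solve 2 (λ l m → m :+ l :* m := (con 1ℤ :+ l) :* m) refl (+ length L) (+ M * + M * (+ n * + n)))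
          (cong (_* (+ M * + M * (+ n * + n))) (sym (ℤ.pos-+ 1 (length L)))))
        (trans (sym (ℤ.*-distribˡ-+ (+ k) _ _))
          (cong (+ k *_) (sym (∑-distrib-+ {k} _ (λ a → energy n (map shift L) (colour-class a))))))
        (ℤ.+-mono-≤ (M²n²≤k∑∥alt∥² v alt) (∑-energy L as))

      ∑-∥colour-class∥² : ∑[ a < k ] ∥ colour-class a ∥² ≡ + N * + N
      ∑-∥colour-class∥² = begin
        ∑[ a < k ] ∥ colour-class a ∥²               ≡⟨ sum-cong-≗ {k} (λ a → ∫-cong (λ x → indicator² a (c x))) ⟩
        ∑[ a < k ] ∫ (colour-class a)                ≡⟨ ∫-∑ colour-class ⟨
        ∫ (λ x → ∑[ a < k ] colour-class a x)        ≡⟨ ∫-cong (λ x → ∑-indicator (c x)) ⟩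
        ∫ (λ _ → 1ℤ)                                 ≡⟨ ∫-product (λ _ → 1ℤ) (λ _ → 1ℤ) ⟩
        ∑[ i < N ] 1ℤ * ∑[ i < N ] 1ℤ                ≡⟨ cong (λ s → s * s) (∑-1 N) ⟩
        + N * + N                                    ∎
        where
        open ≡-Reasoning
        ∑-1 : ∀ m → ∑[ i < m ] 1ℤ ≡ + m
        ∑-1 zero    = refl
        ∑-1 (suc m) = cong (λ s → 1ℤ + s) (∑-1 m)

      -- `∑-energy` bounds the total energy of the colour classes from below, `energy-bound` each of
      -- them from above; the classes partition the torus, so their squared norms add up to N².
      colouring-bound : ∀ {C} L → AllTriples (OddlyRelated C) L →
        All (λ v → ∀ x → Interior M x → Alternates n v c x) L →
        + 3 * (+ length L * (+ M * + M * (+ n * + n))) ≤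
        + k * ((+ 9 * (+ suc n * + suc n) + + 4 * + triples (length L) * (+ C * + C)) * (+ N * + N))
      colouring-bound {C} L related alternates = begin
        + 3 * (+ length L * (+ M * + M * (+ n * + n)))
          ≤⟨ ℤ.*-monoˡ-≤-nonNeg (+ 3) (∑-energy L alternates) ⟩
        + 3 * (+ k * ∑[ a < k ] energy n (map shift L) (colour-class a))
          ≡⟨ solve 2 (λ k e → con (+ 3) :* (k :* e) := k :* (con (+ 3) :* e)) refl (+ k) (∑[ a < k ] energy n (map shift L) (colour-class a)) ⟩
        + k * (+ 3 * ∑[ a < k ] energy n (map shift L) (colour-class a))
          ≡⟨ cong (+ k *_) (*-distribˡ-sum {k} (+ 3) _) ⟩
        + k * ∑[ a < k ] (+ 3 * energy n (map shift L) (colour-class a))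
          ≤⟨ ℤ.*-monoˡ-≤-nonNeg (+ k) (sum-mono {k} λ a → bound a) ⟩
        + k * ∑[ a < k ] (D * ∥ colour-class a ∥²)
          ≡⟨ cong (+ k *_) (trans (sym (*-distribˡ-sum {k} D (λ a → ∥ colour-class a ∥²))) (cong (D *_) ∑-∥colour-class∥²)) ⟩
        + k * (D * (+ N * + N)) ∎
        where
        open ℤ.≤-Reasoning

        D : ℤ
        D = + 9 * (+ suc n * + suc n) + + 4 * + triples (length L) * (+ C * + C)

        commuting : ∀ L → AllPairs _⇄_ (map shift L)
        commuting []      = []
        commuting (u ∷ L) = All.map⁺ (All.universal (shift-⇄ u) L) ∷ commuting L

        relations : ∀ L → AllTriples (OddlyRelated C) L → AllTriples (OddRelation C) (map shift L)
        relations []      []         = []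
        relations (u ∷ L) (ps ∷ pss) =
          AllPairs.map⁺ (AllPairs.map OddlyRelated⇒OddRelation ps) ∷ relations L pss

        bound : ∀ a → + 3 * energy n (map shift L) (colour-class a) ≤ D * ∥ colour-class a ∥²
        bound a = subst
          (λ l → + 3 * energy n (map shift L) (colour-class a) ≤
                 (+ 9 * (+ suc n * + suc n) + + 4 * + triples l * (+ C * + C)) * ∥ colour-class a ∥²)
          (length-map shift L)
          (energy-bound n C (colour-class a) (commuting L) (relations L related))

-- The seventeen vectors and their odd relations

position : Vector → Lattice
-- The columns 3 + √-7 and -4 - 2√-7 form a basis of 2 ℤ[α], the numbers a + b √-7 with a ≡ b mod 2.
-- The cone they span is wide enough to contain one of ± v for each of the seventeen vectors v, so
-- natural coordinates suffice.
position (x , y) = + 3 * + x - + 4 * + y , + x - + 2 * + y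

position-injective : ∀ u v → position u ≡ position v → u ≡ v
position-injective (x , y) (x′ , y′) eq = cong₂ _,_ x≡x′ (ℤ.+-injective
  (ℤ.*-cancelˡ-≡ (+ 2) (+ y) (+ y′) (begin
    + 2 * + y                 ≡⟨ solve 2 (λ x y → con (+ 2) :* y := x :- (x :- con (+ 2) :* y)) refl (+ x) (+ y) ⟩
    + x - (+ x - + 2 * + y)   ≡⟨ cong₂ (λ m z → + m - z) x≡x′ (cong proj₂ eq) ⟩
    + x′ - (+ x′ - + 2 * + y′) ≡⟨ solve 2 (λ x y → con (+ 2) :* y := x :- (x :- con (+ 2) :* y)) refl (+ x′) (+ y′) ⟨
    + 2 * + y′                ∎)))
  where
  open ≡-Reasoning
  recover : ∀ x y → + x ≡ proj₁ (position (x , y)) - + 2 * proj₂ (position (x , y))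
  recover x y = solve 2 (λ x y → x := (con (+ 3) :* x :- con (+ 4) :* y) :- con (+ 2) :* (x :- con (+ 2) :* y)) refl (+ x) (+ y)
  x≡x′ : x ≡ x′
  x≡x′ = ℤ.+-injective (trans (recover x y) (trans (cong (λ P → proj₁ P - + 2 * proj₂ P) eq) (sym (recover x′ y′))))

-- The numbers 2 αⁱ ᾱ¹⁶⁻ⁱ = a + b √-7 for α = (1 + √-7) / 2, up to sign, as
-- preimages of (a , b) under position; they all lie in the first quadrant.
vectors : List Vector
vectors =
  (635 , 364) ∷ (538 , 360) ∷ (172 , 176) ∷ (280 , 96) ∷ (592 , 320) ∷ (608 , 384) ∷
  (320 , 256) ∷ (128 , 0) ∷ (512 , 256) ∷ (640 , 384) ∷ (448 , 320) ∷ (32 , 96) ∷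
  (400 , 176) ∷ (632 , 360) ∷ (548 , 364) ∷ (190 , 186) ∷ (263 , 85) ∷ []

-- Norm 512² is length 1 at mesh 1/512. The largest coordinate among `vectors` is 640; it determines
-- how far n steps can reach.
Short : Vector → Set
Short v@(a , b) = a ℕ.≤ 640 × b ℕ.≤ 640 × norm (position v) (position (0 , 0)) ≡ + 512 * + 512

vectors-short : All Short vectors
vectors-short = from-yes (All.all? (λ (a , b) →
  (a ℕ.≤? 640) ×-dec (b ℕ.≤? 640) ×-dec (norm (position (a , b)) (position (0 , 0)) ℤ.≟ + 512 * + 512)) vectors)

-- The exponent descends, so the first power of 2 found to divide all coefficients is the largest;
-- adding the six remainders tests them together.
reduce : ℕ → Coefficients × Coefficients → Coefficients × Coefficients
reduce zero    pq = pq
reduce (suc k) pq@((p₁ , p₂ , p₃) , (q₁ , q₂ , q₃)) =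
  if does (p₁ % d ℕ.+ p₂ % d ℕ.+ p₃ % d ℕ.+ (q₁ % d ℕ.+ q₂ % d ℕ.+ q₃ % d) ℕ.≟ 0)
  then ((p₁ / d , p₂ / d , p₃ / d) , (q₁ / d , q₂ / d , q₃ / d))
  else reduce k pq
  where
  d = 2 ℕ.^ suc k
  instance
    d≢0 : NonZero d
    d≢0 = ℕ.m^n≢0 2 (suc k)

-- det(v, w) u + det(w, u) v + det(u, v) w = 0, with common factors 2 removed.
-- Truncated subtraction splits each coefficient into positive and negative part.
cramer : Vector → Vector → Vector → Coefficients × Coefficients
cramer (u₁ , u₂) (v₁ , v₂) (w₁ , w₂) = reduce 16
  ( (v₁ ℕ.* w₂ ℕ.∸ v₂ ℕ.* w₁ , w₁ ℕ.* u₂ ℕ.∸ w₂ ℕ.* u₁ , u₁ ℕ.* v₂ ℕ.∸ u₂ ℕ.* v₁)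
  , (v₂ ℕ.* w₁ ℕ.∸ v₁ ℕ.* w₂ , w₂ ℕ.* u₁ ℕ.∸ w₁ ℕ.* u₂ , u₂ ℕ.* v₁ ℕ.∸ u₁ ℕ.* v₂) )

oddBalance? : ∀ C u v w pq → Dec (OddBalance C u v w pq)
oddBalance? C u v w pq =
  map′ (uncurry (cong₂ _,_)) (λ eq → cong proj₁ eq , cong proj₂ eq) ((_ ℕ.≟ _) ×-dec (_ ℕ.≟ _))
  ×-dec (_ ℕ.≟ 1) ×-dec (_ ℕ.≤? C)

allTriples? : ∀ {A : Set} {R : A → A → A → Set} → (∀ x y z → Dec (R x y z)) → ∀ xs → Dec (AllTriples R xs)
allTriples? R? []       = yes []
allTriples? R? (x ∷ xs) = map′ (λ (p , ps) → p ∷ ps) (λ { (p ∷ ps) → p , ps })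
  (AllPairs.allPairs? (R? x) xs ×-dec allTriples? R? xs)

AllTriples-map : ∀ {A : Set} {R S : A → A → A → Set} → (∀ {x y z} → R x y z → S x y z) →
                 ∀ {xs} → AllTriples R xs → AllTriples S xs
AllTriples-map f []       = []
AllTriples-map f (p ∷ ps) = AllPairs.map f p ∷ AllTriples-map f ps

Balanced : Vector → Vector → Vector → Set
Balanced u v w = OddBalance 128000 u v w (cramer u v w)

balanced? : ∀ u v w → Dec (Balanced u v w)
balanced? u v w = oddBalance? 128000 u v w (cramer u v w)

-- Existence of coefficients is not searched for: `cramer` computes them, and the check of all 680
-- triples is plain evaluation.
vectors-related : AllTriples (OddlyRelated 128000) vectors
vectors-related = AllTriples-map {R = Balanced} (λ {u} {v} {w} balance → cramer u v w , balance)
  (toWitness {a? = allTriples? balanced? vectors} tt)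

-- The conclusion of `colouring-bound` for 17 vectors, 680 triples and relation weight 128000.
GridBound : ℕ → ℕ → ℕ → ℕ → Set
GridBound k N M n = + 3 * (+ 17 * (+ M * + M * (+ n * + n))) ≤
  + k * ((+ 9 * (+ suc n * + suc n) + + 4 * + 680 * (+ 128000 * + 128000)) * (+ N * + N))

gridBound? : ∀ k N M n → Dec (GridBound k N M n)
gridBound? k N M n = _ ℤ.≤? _

-- A grid that five colours cannot colour

module _ (N : ℕ) .{{N≢0 : NonZero N}} where

  private module T = Torus N

  grid : Fin (N ℕ.* N) → Lattice
  grid i = let (x , y) = remQuot {N} N i in position (toℕ x , toℕ y)

  grid-injective : ∀ {i j} → grid i ≡ grid j → i ≡ j
  grid-injective {i} {j} eq =
    trans (sym (Fin.combine-remQuot {N} N i)) (trans (cong (uncurry combine) rem≡) (Fin.combine-remQuot {N} N j))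
    where
    coords≡ : (toℕ (proj₁ (remQuot {N} N i)) , toℕ (proj₂ (remQuot {N} N i))) ≡
              (toℕ (proj₁ (remQuot {N} N j)) , toℕ (proj₂ (remQuot {N} N j)))
    coords≡ = position-injective (toℕ (proj₁ (remQuot {N} N i)) , toℕ (proj₂ (remQuot {N} N i)))
                                 (toℕ (proj₁ (remQuot {N} N j)) , toℕ (proj₂ (remQuot {N} N j))) eq
    rem≡ : remQuot {N} N i ≡ remQuot {N} N j
    rem≡ = cong₂ _,_ (Fin.toℕ-injective (cong proj₁ coords≡)) (Fin.toℕ-injective (cong proj₂ coords≡))

  module _ {M n k} (M+640n≤N : M ℕ.+ n ℕ.* 640 ℕ.≤ N) (c : Fin (N ℕ.* N) → Fin k) (proper : Proper grid c) where

    colour : T.X → Fin k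
    colour (x , y) = c (combine x y)

    no-wrap : ∀ {a} (x : Fin N) i → toℕ x ℕ.< M → a ℕ.≤ 640 → i ℕ.< n → toℕ (x T.⊞ i ℕ.* a) ≡ toℕ x ℕ.+ i ℕ.* a
    no-wrap x i x<M a≤640 i<n = T.toℕ-⊞-small x
      (ℕ.<-≤-trans (ℕ.+-mono-<-≤ x<M (ℕ.*-mono-≤ (ℕ.<⇒≤ i<n) a≤640)) M+640n≤N)

    grid-⊞₂ : ∀ {v} x i → T.Interior M x → Short v → i ℕ.< n →
      grid (uncurry combine (x T.⊞₂ i • v)) ≡ position (toℕ (proj₁ x) ℕ.+ i ℕ.* proj₁ v , toℕ (proj₂ x) ℕ.+ i ℕ.* proj₂ v)
    grid-⊞₂ {a , b} (x , y) i (x<M , y<M) (a≤ , b≤ , _) i<n = trans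
      (cong (λ (x , y) → position (toℕ x , toℕ y)) (Fin.remQuot-combine (x T.⊞ i ℕ.* a) (y T.⊞ i ℕ.* b)))
      (cong position (cong₂ _,_ (no-wrap x i x<M a≤ i<n) (no-wrap y i y<M b≤ i<n)))

    -- `position` is linear and `norm` quadratic, so d steps along v multiply its norm 512² by d².
    steps-apart : ∀ {v} → Short v → ∀ x y i d → parity d ≡ 1ℙ →
      OddlyApart (position (x ℕ.+ i ℕ.* proj₁ v , y ℕ.+ i ℕ.* proj₂ v))
                 (position (x ℕ.+ (i ℕ.+ d) ℕ.* proj₁ v , y ℕ.+ (i ℕ.+ d) ℕ.* proj₂ v))
    steps-apart {a , b} (_ , _ , norm≡) x y i d odd = d , odd , (begin
      norm (position (x ℕ.+ i ℕ.* a , y ℕ.+ i ℕ.* b)) (position (x ℕ.+ (i ℕ.+ d) ℕ.* a , y ℕ.+ (i ℕ.+ d) ℕ.* b))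
        ≡⟨ cong₂ (λ (x , y) (x′ , y′) → norm (+ 3 * x - + 4 * y , x - + 2 * y) (+ 3 * x′ - + 4 * y′ , x′ - + 2 * y′))
             (cong₂ _,_ (cast x i a) (cast y i b))
             (cong₂ _,_ (cast′ x a) (cast′ y b)) ⟩
      norm (+ 3 * (+ x + + i * + a) - + 4 * (+ y + + i * + b) , (+ x + + i * + a) - + 2 * (+ y + + i * + b))
           (+ 3 * (+ x + (+ i + + d) * + a) - + 4 * (+ y + (+ i + + d) * + b) , (+ x + (+ i + + d) * + a) - + 2 * (+ y + (+ i + + d) * + b))
        ≡⟨ solve 6 (λ x y i d a b →
             let u = (con (+ 3) :* (x :+ i :* a) :- con (+ 4) :* (y :+ i :* b)) :-
                     (con (+ 3) :* (x :+ (i :+ d) :* a) :- con (+ 4) :* (y :+ (i :+ d) :* b))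
                 v = ((x :+ i :* a) :- con (+ 2) :* (y :+ i :* b)) :-
                     ((x :+ (i :+ d) :* a) :- con (+ 2) :* (y :+ (i :+ d) :* b))
                 u₀ = (con (+ 3) :* a :- con (+ 4) :* b) :- con 0ℤ
                 v₀ = (a :- con (+ 2) :* b) :- con 0ℤ
             in u :* u :+ con (+ 7) :* (v :* v) := d :* d :* (u₀ :* u₀ :+ con (+ 7) :* (v₀ :* v₀))) refl
             (+ x) (+ y) (+ i) (+ d) (+ a) (+ b) ⟩
      + d * + d * norm (position (a , b)) (position (0 , 0))
        ≡⟨ cong (+ d * + d *_) norm≡ ⟩
      + d * + d * (+ 512 * + 512)
        ≡⟨ solve 2 (λ d m → d :* d :* (m :* m) := (m :* d) :* (m :* d)) refl (+ d) (+ 512) ⟩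
      (+ 512 * + d) * (+ 512 * + d)
        ≡⟨ cong (λ z → z * z) (ℤ.pos-* 512 d) ⟨
      + (512 ℕ.* d) * + (512 ℕ.* d) ∎)
      where
      open ≡-Reasoning
      cast : ∀ x i a → + (x ℕ.+ i ℕ.* a) ≡ + x + + i * + a
      cast x i a = trans (ℤ.pos-+ x (i ℕ.* a)) (cong (λ m → + x + m) (ℤ.pos-* i a))
      cast′ : ∀ x a → + (x ℕ.+ (i ℕ.+ d) ℕ.* a) ≡ + x + (+ i + + d) * + a
      cast′ x a = trans (cast x (i ℕ.+ d) a) (cong (λ m → + x + m * + a) (ℤ.pos-+ i d))

    colour-alternates : ∀ {v} → Short v → ∀ x → T.Interior M x →
                        T.Alternates n v colour x
    colour-alternates {v} short x interior i d odd i+d<n = proper _ _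
      (subst₂ OddlyApart
        (sym (grid-⊞₂ {v} x i interior short (ℕ.≤-<-trans (ℕ.m≤m+n i d) i+d<n)))
        (sym (grid-⊞₂ {v} x (i ℕ.+ d) interior short i+d<n))
        (steps-apart {v} short (toℕ (proj₁ x)) (toℕ (proj₂ x)) i d odd))

    grid-bound : GridBound k N M n
    grid-bound = T.colouring-bound colour (ℕ.≤-trans (ℕ.m≤m+n M _) M+640n≤N) vectors vectors-related
      (All.map (λ {v} short → colour-alternates {v} short) vectors-short)

-- With 120 · 128000 steps the relation error 4 · 680 · 128000² is dominated, and
-- a side of 13440 · steps makes the boundary strip of width 640 · steps negligible.
grid-not-5-colourable : ∃ λ N → ¬ Colourable 5 (grid (suc N))
-- One less than the side, which appears as a successor to be visibly nonzero.
grid-not-5-colourable = 206438399999 , λ (c , proper) →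
  contradiction (grid-bound 206438400000 {196608000000} {15360000} room c proper) too-big
  where
  room : 196608000000 ℕ.+ 15360000 ℕ.* 640 ℕ.≤ 206438400000
  room = toWitness {a? = 196608000000 ℕ.+ 15360000 ℕ.* 640 ℕ.≤? 206438400000} tt
  -- Divided by n² N², the left side is 51 (20/21)² ≈ 46.26, as M/N = 12800/13440, and the right
  -- side is about 45 + 13600/120² ≈ 45.94.
  too-big : ¬ GridBound 5 206438400000 196608000000 15360000
  too-big = toWitnessFalse {a? = gridBound? 5 206438400000 196608000000 15360000} tt

mainTheorem1 : ∃[ V ] HasChromaticNumber (oddDistanceGraph V) 6
mainTheorem1 = let (N , ¬colourable) = grid-not-5-colourable in
  chromatic-number-attained 5 (grid (suc N)) (grid-injective (suc N)) ¬colourable
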